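{- Let $m,n$ be square-free positive integers with $\gcd(m,n)=1$ and $N\varepsilon_{mn}=1$, such that every prime $p\mid m$ satisfies $p\equiv1\pmod4$. Let \[P=\{p\text{ prime}:p\mid m,\ (n/p)=-1\}\cup\{q\text{ prime}:q\mid n,\ (m/q)=-1\}\cup P_2,\] where $P_2=\{2\}$ if $m\equiv5\pmod8$ and $n\equiv3\pmod4$, and $P_2=\emptyset$ otherwise. Let $F=\mathbb{Q}(\sqrt{mn})$ and let $d$ be a square-free positive integer with $F(\sqrt{\varepsilon_{mn}})=F(\sqrt d)$, where $d\mid 2mn$ if $n\equiv3\pmod4$ and $d\mid mn$ otherwise. Let $D$ be the set of prime divisors of $d$. Then $|D\cap P|$ is even.
   Context: $\varepsilon_{mn}$ is the positive (real, $\sqrt{mn}>0$) fundamental unit of $\mathbb{Q}(\sqrt{mn})$, $N\varepsilon_{mn}$ its norm to $\mathbb{Q}$; fields are subfields of $\mathbb{R}$. $(x/p)$ is the Legendre symbol for an odd prime $p\nmid x$; for odd $x$, $(x/2)=+1$ if $x\equiv\pm1\pmod8$ and $-1$ if $x\equiv\pm5\pmod8$. -}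

module Defs where

open import Data.Nat as ℕ using (ℕ; _%_)
open import Data.Nat.Primality using (Prime)
import Data.Nat.Divisibility as ℕD
open import Data.Integer as ℤ using (ℤ; +_; 0ℤ; _-_; -_)
open import Data.Integer.Divisibility as ℤD using ()
open import Data.Product using (_×_; ∃)
open import Data.Sum using (_⊎_)
open import Relation.Nullary using (¬_)
open import Relation.Binary.PropositionalEquality using (_≡_)

-- square-free natural number (0 is not square-free)
SquareFree : ℕ → Set
SquareFree n = ∀ p → Prime p → ¬ (p ℕ.* p ℕD.∣ n)

-- Legendre symbol (x/p) = -1, with the paper's convention at p = 2
-- (for odd x: (x/2) = -1 iff x ≡ ±5 mod 8).  For odd p: p ∤ x and x is
-- not a square modulo p.
LegendreNeg : ℕ → ℕ → Set
LegendreNeg x p =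
    (p ≡ 2 × (x % 8 ≡ 3 ⊎ x % 8 ≡ 5))
  ⊎ (¬ (p ≡ 2) × ¬ (p ℕD.∣ x) × ¬ (∃ λ (y : ℤ) → (+ p) ℤD.∣ (y ℤ.* y - + x)))

-- Elements of F = Q(√D) are written x + y√D; an element (a + b√D)/2 is
-- represented by the integer pair (a , b).

-- x + y √D > 0 (real embedding, √D > 0)
Pos : ℕ → ℤ → ℤ → Set
Pos D x y =
    (0ℤ ℤ.≤ x × 0ℤ ℤ.≤ y × ¬ (x ≡ 0ℤ × y ≡ 0ℤ))
  ⊎ (0ℤ ℤ.< x × y ℤ.< 0ℤ × (+ D) ℤ.* y ℤ.* y ℤ.< x ℤ.* x)
  ⊎ (x ℤ.< 0ℤ × 0ℤ ℤ.< y × x ℤ.* x ℤ.< (+ D) ℤ.* y ℤ.* y)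

Norm4 : ℕ → ℤ → ℤ → ℤ
Norm4 D a b = a ℤ.* a - (+ D) ℤ.* b ℤ.* b

-- (a + b√D)/2 is a unit of the ring of integers of Q(√D):
-- every algebraic integer of Q(√D) has the form (a+b√D)/2 with a, b ∈ ℤ,
-- and it is a unit iff its norm is ±1.
IsUnit : ℕ → ℤ → ℤ → Set
IsUnit D a b = Norm4 D a b ≡ + 4 ⊎ Norm4 D a b ≡ - (+ 4)

Gt1 : ℕ → ℤ → ℤ → Set
Gt1 D a b = Pos D (a - + 2) b

Geq : ℕ → ℤ → ℤ → ℤ → ℤ → Set
Geq D c e a b = Pos D (c - a) (e - b) ⊎ (c ≡ a × e ≡ b)

FundamentalUnit : ℕ → ℤ → ℤ → Set
FundamentalUnit D a b =
  IsUnit D a b × Gt1 D a b ×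
  (∀ c e → IsUnit D c e → Gt1 D c e → Geq D c e a b)

-- F(√ε) = F(√d) for ε = (a+b√D)/2, F = Q(√D), expressed as: d·ε is a
-- square in F, i.e. ∃ rationals X = x/z, Y = y/z with (X + Y√D)² = d·ε.
SameSqrtExt : ℕ → ℤ → ℤ → ℕ → Set
SameSqrtExt D a b d = ∃ λ (x : ℤ) → ∃ λ (y : ℤ) → ∃ λ (z : ℤ) →
  ¬ (z ≡ 0ℤ) ×
  (+ 2) ℤ.* (x ℤ.* x ℤ.+ (+ D) ℤ.* y ℤ.* y) ≡ z ℤ.* z ℤ.* (+ d) ℤ.* a ×
  (+ 4) ℤ.* x ℤ.* y ≡ z ℤ.* z ℤ.* (+ d) ℤ.* b

InP : ℕ → ℕ → ℕ → Set
InP m n p =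
    (Prime p × p ℕD.∣ m × LegendreNeg n p)
  ⊎ (Prime p × p ℕD.∣ n × LegendreNeg m p)
  ⊎ (p ≡ 2 × m % 8 ≡ 5 × n % 4 ≡ 3)

{-# OPTIONS --safe #-}

-- A solution of (X + Y √(mn))² = d ε with N ε = 1 gives a primitive integral solution of
-- x² − mn y² = ± d z².  Put e = gcd(d, m), d = e f, m = e m′.  Reading the equation modulo m′,
-- and modulo e after dividing by e, yields the Jacobi symbols (e f / m′) = 1 and
-- (m′ n f / e) = 1 (signs are irrelevant because e, m′ ≡ 1 mod 4).  Quadratic reciprocity
-- turns their product into (f / m)(n / e) = 1, and this product is exactly (−1)^|D ∩ P|,
-- since (f / m) = ∏ (q / m) over primes q ∣ f and (n / e) = ∏ (n / p) over primes p ∣ e.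
--
-- The Jacobi symbol is defined by the sign count of Gauss's lemma, for any odd modulus, so
-- that multiplicativity and reciprocity hold without reference to primes; only its relation
-- to nonsquares needs a prime modulus, where it follows from X^((p−1)/2) − 1 having at
-- most (p−1)/2 roots.

module Submission where

open import Defs
open import Data.Empty using (⊥; ⊥-elim)
open import Data.Integer as ℤ using (ℤ; +_; _+_; _*_; _-_; -_; ∣_∣; _◃_; 0ℤ; 1ℤ; _^_)
import Data.Integer.Divisibility as Unsigned
open import Data.Integer.Divisibility.Signed using (_∣_; divides; ∣⇒∣ᵤ; ∣ᵤ⇒∣; ∣m∣n⇒∣m+n; ∣m⇒∣-m; ∣n⇒∣m*n; ∣m⇒∣m*n)
open import Data.Integer.DivMod using (_%ℕ_; _/ℕ_; a≡a%ℕn+[a/ℕn]*n; n%ℕd<d)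
import Data.Integer.Properties as ℤ
open import Data.Integer.Tactic.RingSolver using (solve-∀)
open import Data.List using (List; []; _∷_; length; map; _++_; applyUpTo; replicate)
open import Data.List.Membership.Propositional using (_∈_; _∉_)
open import Data.List.Membership.Propositional.Properties using (∈-∃++; ∈-applyUpTo⁺; ∈-applyUpTo⁻)
open import Data.List.Properties using (length-applyUpTo; length-map; length-replicate)
open import Data.List.Relation.Binary.Permutation.Propositional as ↭ using (_↭_; ↭-trans; ↭-sym; ↭-refl)
open import Data.List.Relation.Binary.Permutation.Propositional.Properties using (shift; ↭-length; ∈-resp-↭; All-resp-↭)
open import Data.List.Relation.Unary.All as All using (All; []; _∷_)
import Data.List.Relation.Unary.All.Properties as All
open import Data.List.Relation.Unary.AllPairs using (AllPairs; []; _∷_)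
import Data.List.Relation.Unary.AllPairs.Properties as AllPairs
open import Data.List.Relation.Unary.Any using (here; there)
open import Data.List.Relation.Unary.Unique.Propositional using (Unique)
import Data.List.Relation.Unary.Unique.Propositional.Properties as Unique
open import Data.Nat as ℕ using (ℕ; zero; suc; z≤n; s≤s; NonZero; ⌊_/2⌋)
open import Data.Nat.Coprimality as Coprime using (Coprime; coprime-divisor; prime⇒coprime)
import Data.Nat.Divisibility as ℕ
import Data.Nat.DivMod as ℕ
open import Data.Nat.GCD using (gcd; gcd[m,n]∣m; gcd[m,n]∣n; gcd-greatest; gcd[m,n]≢0)
open import Data.Nat.ListAction using (product)
open import Data.Nat.ListAction.Properties using (product-↭; product-++; ∈⇒∣product)
open import Data.Nat.Primality using (Prime; euclidsLemma; prime⇒irreducible; ¬prime[1]; prime⇒nonZero; prime[2]; irreducible[2])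
open import Data.Nat.Primality.Factorisation using (PrimeFactorisation; factorise; factorisationHasAllPrimeFactors)
import Data.Nat.Properties as ℕ
import Data.Nat.Tactic.RingSolver as ℕSolver
open import Data.Product using (_×_; _,_; ∃; proj₁; proj₂)
open import Data.Sign using (Sign; opposite) renaming (+ to ⊕; - to ⊖; _*_ to _·_)
open import Data.Sign.Properties using (*-commutativeSemigroup; *-assoc; *-comm; *-identityʳ; *-cancelʳ-≡; s*s≡+)
open import Algebra.Properties.CommutativeSemigroup *-commutativeSemigroup using (interchange; x∙yz≈y∙xz)
open import Data.Sum as Sum using (_⊎_; inj₁; inj₂; [_,_]′)
open import Function using (_∘_; id)
open import Function.Bundles using (_⇔_; Equivalence)
open import Relation.Binary.PropositionalEquality hiding ([_]; J)
open import Relation.Nullary using (¬_; Dec; yes; no; contradiction)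

-- The symbols extracted from the conic have only divisors of m as moduli. These are odd and 1
-- modulo 4, so the unknown sign of the norm disappears. The prime 2 may divide n or f, hence it is
-- kept in numerators, where (2/m) = -1 means m ≡ 5 modulo 8; that one symbol accounts both for the
-- convention at 2 and for P₂. Primitivity of (x, y, z) excludes only a prime common to all three
-- coordinates, while the symbols require z prime to m′ and y prime to e. Square-freeness of m and d
-- bridges this gap. The set D ∩ P enters as a duplicate-free list, and the parity of its length is
-- computed as a product of signs over the prime factors of d.

private variable
  A B : Set

-- Products of signs, parity and permutations of finite lists

∏ : (A → Sign) → List A → Sign
∏ f []       = ⊕
∏ f (x ∷ xs) = f x · ∏ f xs

∏-cong : ∀ {f g : A → Sign} xs → (∀ {x} → x ∈ xs → f x ≡ g x) → ∏ f xs ≡ ∏ g xs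
∏-cong []       f≗g = refl
∏-cong (x ∷ xs) f≗g = cong₂ _·_ (f≗g (here refl)) (∏-cong xs (f≗g ∘ there))

∏-map : ∀ (f : B → Sign) (g : A → B) xs → ∏ f (map g xs) ≡ ∏ (f ∘ g) xs
∏-map f g []       = refl
∏-map f g (x ∷ xs) = cong (f (g x) ·_) (∏-map f g xs)

∏-· : ∀ (f g : A → Sign) xs → ∏ (λ x → f x · g x) xs ≡ ∏ f xs · ∏ g xs
∏-· f g []       = refl
∏-· f g (x ∷ xs) = trans (cong (f x · g x ·_) (∏-· f g xs)) (interchange (f x) (g x) _ _)

∏-++ : ∀ (f : A → Sign) xs ys → ∏ f (xs ++ ys) ≡ ∏ f xs · ∏ f ys
∏-++ f []       ys = refl
∏-++ f (x ∷ xs) ys = trans (cong (f x ·_) (∏-++ f xs ys)) (sym (*-assoc (f x) _ _))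

∏-⊕ : ∀ (xs : List A) → ∏ (λ _ → ⊕) xs ≡ ⊕
∏-⊕ []       = refl
∏-⊕ (x ∷ xs) = ∏-⊕ xs

∏-swap : ∀ (f : A → B → Sign) xs ys → ∏ (λ x → ∏ (f x) ys) xs ≡ ∏ (λ y → ∏ (λ x → f x y) xs) ys
∏-swap f []       ys = sym (∏-⊕ ys)
∏-swap f (x ∷ xs) ys = trans (cong (∏ (f x) ys ·_) (∏-swap f xs ys)) (sym (∏-· (f x) _ ys))

∏-↭ : ∀ (f : A → Sign) {xs ys} → xs ↭ ys → ∏ f xs ≡ ∏ f ys
∏-↭ f ↭.refl          = refl
∏-↭ f (↭.prep x p)    = cong (f x ·_) (∏-↭ f p)
∏-↭ f (↭.swap x y p)  = trans (cong (λ s → f x · (f y · s)) (∏-↭ f p)) (x∙yz≈y∙xz (f x) (f y) _)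
∏-↭ f (↭.trans p q)   = trans (∏-↭ f p) (∏-↭ f q)

parity : ℕ → Sign
parity zero    = ⊕
parity (suc n) = opposite (parity n)

opposite-·ˡ : ∀ s t → opposite s · t ≡ opposite (s · t)
opposite-·ˡ ⊕ ⊕ = refl
opposite-·ˡ ⊕ ⊖ = refl
opposite-·ˡ ⊖ ⊕ = refl
opposite-·ˡ ⊖ ⊖ = refl

parity-+ : ∀ a b → parity (a ℕ.+ b) ≡ parity a · parity b
parity-+ zero    b = refl
parity-+ (suc a) b = trans (cong opposite (parity-+ a b)) (sym (opposite-·ˡ (parity a) _))

parity-double : ∀ n → parity (n ℕ.+ n) ≡ ⊕
parity-double n = trans (parity-+ n n) (s*s≡+ (parity n))

∏-⊖ : ∀ (xs : List A) → ∏ (λ _ → ⊖) xs ≡ parity (length xs)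
∏-⊖ []       = refl
∏-⊖ (x ∷ xs) = trans (cong (⊖ ·_) (∏-⊖ xs)) (opposite-·ˡ ⊕ (parity (length xs)))

∏-const-even : ∀ s (xs : List A) → parity (length xs) ≡ ⊕ → ∏ (λ _ → s) xs ≡ ⊕
∏-const-even ⊕ xs even = ∏-⊕ xs
∏-const-even ⊖ xs even = trans (∏-⊖ xs) even

≢-head : ∀ {x y : A} {xs} → All (λ z → ¬ x ≡ z) xs → y ∈ xs → ¬ y ≡ x
≢-head x≢ y∈xs y≡x = All.lookup x≢ y∈xs (sym y≡x)

-- Pigeonhole: each element of `xs` is struck out of `ys` in turn, and the length bound leaves
-- nothing of `ys` over. Membership itself supplies the splitting of `ys`, so no equality test is
-- used.
Unique-⊆-↭ : ∀ {xs ys : List A} → Unique xs → (∀ {x} → x ∈ xs → x ∈ ys) →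
             length ys ℕ.≤ length xs → xs ↭ ys
Unique-⊆-↭ {xs = []} {[]} [] sub len = ↭-refl
Unique-⊆-↭ {xs = x ∷ xs} (x∉ ∷ u) sub len with ∈-∃++ (sub (here refl))
... | as , bs , refl = ↭-trans (↭.prep x (Unique-⊆-↭ u sub′ len′)) (↭-sym (shift x as bs))
  where
  sub′ : ∀ {y} → y ∈ xs → y ∈ as ++ bs
  sub′ y∈ with ∈-resp-↭ (shift x as bs) (sub (there y∈))
  ... | here y≡x = contradiction y≡x (≢-head x∉ y∈)
  ... | there y∈′ = y∈′
  len′ : length (as ++ bs) ℕ.≤ length xs
  len′ = ℕ.≤-pred (subst (ℕ._≤ suc (length xs)) (↭-length (shift x as bs)) len)

Unique-map : ∀ (f : A → B) {xs} → (∀ {x y} → x ∈ xs → y ∈ xs → f x ≡ f y → x ≡ y) →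
             Unique xs → Unique (map f xs)
Unique-map f inj [] = []
Unique-map f {x ∷ xs} inj (x∉ ∷ u) =
  go (λ y∈ → All.lookup x∉ y∈ ∘ inj (here refl) (there y∈)) ∷ Unique-map f (λ y∈ z∈ → inj (there y∈) (there z∈)) u
  where
  go : ∀ {zs} → (∀ {y} → y ∈ zs → ¬ f x ≡ f y) → All (λ y → ¬ f x ≡ y) (map f zs)
  go {[]}     h = []
  go {z ∷ zs} h = h (here refl) ∷ go (h ∘ there)

-- An injective self-map of a finite set is onto. This allows absolute residues of multiples to be
-- relabelled.
map-↭ : ∀ (f : A → A) {xs} → Unique xs → (∀ {x} → x ∈ xs → f x ∈ xs) →
        (∀ {x y} → x ∈ xs → y ∈ xs → f x ≡ f y → x ≡ y) → map f xs ↭ xs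
map-↭ {A} f {xs} u closed inj = Unique-⊆-↭ (Unique-map f inj u) (λ z∈ → sub xs closed z∈) (ℕ.≤-reflexive (sym (length-map f xs)))
  where
  sub : ∀ ys → (∀ {x} → x ∈ ys → f x ∈ xs) → ∀ {z} → z ∈ map f ys → z ∈ xs
  sub (y ∷ ys) c (here refl) = c (here refl)
  sub (y ∷ ys) c (there z∈)    = sub ys (c ∘ there) z∈

-- Turns a product of signs into a count: each element of `l` is pulled to the front of `L`, where
-- it contributes one minus sign, and what remains contributes plus signs. It serves for lattice
-- points, for the symbol of 2 and for D ∩ P alike.
∏-indicator : ∀ (e : A → Sign) l {L} → Unique l → Unique L → (∀ {x} → x ∈ l → x ∈ L) →
              (∀ {x} → x ∈ L → x ∈ l → e x ≡ ⊖) → (∀ {x} → x ∈ L → x ∉ l → e x ≡ ⊕) →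
              ∏ e L ≡ parity (length l)
∏-indicator e [] {L} ul uL sub neg pos = trans (∏-cong L (λ x∈ → pos x∈ λ ())) (∏-⊕ L)
∏-indicator e (x ∷ l) {L} (x∉l ∷ ul) uL sub neg pos with ∈-∃++ (sub (here refl))
... | as , bs , refl = begin
  ∏ e (as ++ x ∷ bs)           ≡⟨ ∏-↭ e (shift x as bs) ⟩
  e x · ∏ e (as ++ bs)         ≡⟨ cong₂ _·_ (neg (sub (here refl)) (here refl)) rec ⟩
  ⊖ · parity (length l)        ≡⟨ opposite-·ˡ ⊕ (parity (length l)) ⟩
  opposite (parity (length l)) ∎
  where
  open ≡-Reasoning
  up : ∀ {y} → y ∈ as ++ bs → y ∈ as ++ x ∷ bs
  up y∈ = ∈-resp-↭ (↭-sym (shift x as bs)) (there y∈)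
  uniq : ∀ as → Unique (as ++ x ∷ bs) → All (λ y → ¬ x ≡ y) (as ++ bs) × Unique (as ++ bs)
  uniq [] (x∉ ∷ u) = x∉ , u
  uniq (a ∷ as) (a∉ ∷ u) = (a≢x ∘ sym) ∷ proj₁ (uniq as u) , a∉′ ∷ proj₂ (uniq as u)
    where
    a≢x : ¬ a ≡ x
    a≢x = All.head (All-resp-↭ (shift x as bs) a∉)
    a∉′ = All.tail (All-resp-↭ (shift x as bs) a∉)
  sub′ : ∀ {y} → y ∈ l → y ∈ as ++ bs
  sub′ y∈ with ∈-resp-↭ (shift x as bs) (sub (there y∈))
  ... | here y≡x = contradiction y≡x (≢-head x∉l y∈)
  ... | there y∈′ = y∈′
  pos′ : ∀ {y} → y ∈ as ++ bs → y ∉ l → e y ≡ ⊕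
  pos′ y∈ y∉l = pos (up y∈) λ where
    (here y≡x) → ≢-head (proj₁ (uniq as uL)) y∈ y≡x
    (there y∈l) → y∉l y∈l
  rec = ∏-indicator e l ul (proj₂ (uniq as uL)) sub′ (λ y∈ → neg (up y∈) ∘ there) pos′

-- Index ranges and congruences between integers

[1⋯_] : ℕ → List ℕ
[1⋯ h ] = applyUpTo suc h

∈-[1⋯]⁺ : ∀ {h i} → 0 ℕ.< i → i ℕ.≤ h → i ∈ [1⋯ h ]
∈-[1⋯]⁺ {i = suc i} _ i<h = ∈-applyUpTo⁺ suc i<h

∈-[1⋯]⁻ : ∀ {h i} → i ∈ [1⋯ h ] → 0 ℕ.< i × i ℕ.≤ h
∈-[1⋯]⁻ {h} i∈ with ∈-applyUpTo⁻ suc i∈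
... | j , j<h , refl = s≤s z≤n , j<h

[1⋯]-unique : ∀ h → Unique [1⋯ h ]
[1⋯]-unique h = Unique.applyUpTo⁺₁ suc h (λ i<j _ eq → ℕ.<⇒≢ i<j (ℕ.suc-injective eq))

infix 4 _≈_[_]
record _≈_[_] (a b : ℤ) (k : ℕ) : Set where
  constructor congruent
  field difference : + k ∣ a - b
open _≈_[_]

≈-reflexive : ∀ {k a b} → a ≡ b → a ≈ b [ k ]
≈-reflexive {a = a} refl = congruent (divides 0ℤ (ℤ.+-inverseʳ a))

≈-sym : ∀ {k a b} → a ≈ b [ k ] → b ≈ a [ k ]
≈-sym {k} {a} {b} (congruent p) = congruent (subst (+ k ∣_) (eq a b) (∣m⇒∣-m p))
  where
  eq : ∀ a b → - (a - b) ≡ b - a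
  eq = solve-∀

≈-trans : ∀ {k a b c} → a ≈ b [ k ] → b ≈ c [ k ] → a ≈ c [ k ]
≈-trans {k} {a} {b} {c} (congruent p) (congruent q) =
  congruent (subst (+ k ∣_) (eq a b c) (∣m∣n⇒∣m+n p q))
  where
  eq : ∀ a b c → (a - b) + (b - c) ≡ a - c
  eq = solve-∀

≈-* : ∀ {k a b c d} → a ≈ b [ k ] → c ≈ d [ k ] → a * c ≈ b * d [ k ]
≈-* {k} {a} {b} {c} {d} (congruent p) (congruent q) =
  congruent (subst (+ k ∣_) (eq a b c d) (∣m∣n⇒∣m+n (∣m⇒∣m*n c p) (∣n⇒∣m*n b q)))
  where
  eq : ∀ a b c d → (a - b) * c + b * (c - d) ≡ a * c - b * d
  eq = solve-∀

≈0⇒∣ : ∀ {k a} → a ≈ 0ℤ [ k ] → k ℕ.∣ ∣ a ∣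
≈0⇒∣ {k} {a} (congruent p) = ∣⇒∣ᵤ (subst (+ k ∣_) (ℤ.+-identityʳ a) p)

∣⇒≈0 : ∀ {k a} → k ℕ.∣ ∣ a ∣ → a ≈ 0ℤ [ k ]
∣⇒≈0 {k} {a} p = congruent (subst (+ k ∣_) (sym (ℤ.+-identityʳ a)) (∣ᵤ⇒∣ p))

∣-resp-≈ : ∀ {k a b} → a ≈ b [ k ] → k ℕ.∣ ∣ a ∣ → k ℕ.∣ ∣ b ∣
∣-resp-≈ p q = ≈0⇒∣ (≈-trans (≈-sym p) (∣⇒≈0 q))

-- Least absolute residues and Gauss's sign count for an odd modulus

module Residue (h : ℕ) where

  k : ℕ
  k = suc (h ℕ.+ h)

  abstract
    -- The residue of y of least absolute value is σ y ◃ α y.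
    σ : ℤ → Sign
    σ y with y %ℕ k ℕ.≤? h
    ... | yes _ = ⊕
    ... | no  _ = ⊖

    α : ℤ → ℕ
    α y with y %ℕ k ℕ.≤? h
    ... | yes _ = y %ℕ k
    ... | no  _ = k ℕ.∸ y %ℕ k

    σα-cases : ∀ y → (σ y ≡ ⊕ × α y ≡ y %ℕ k × y %ℕ k ℕ.≤ h) ⊎
                     (σ y ≡ ⊖ × y %ℕ k ℕ.+ α y ≡ k × h ℕ.< y %ℕ k)
    σα-cases y with y %ℕ k ℕ.≤? h
    ... | yes r≤h = inj₁ (refl , refl , r≤h)
    ... | no  r≰h = inj₂ (refl , ℕ.m+[n∸m]≡n (ℕ.<⇒≤ (n%ℕd<d y k)) , ℕ.≰⇒> r≰h)

  α≤h : ∀ y → α y ℕ.≤ h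
  α≤h y with σα-cases y
  ... | inj₁ (_ , α≡r , r≤h)   = subst (ℕ._≤ h) (sym α≡r) r≤h
  ... | inj₂ (_ , r+α≡k , h<r) = ℕ.+-cancelˡ-≤ (suc h) (α y) h (begin
    suc h ℕ.+ α y       ≤⟨ ℕ.+-monoˡ-≤ (α y) h<r ⟩
    y %ℕ k ℕ.+ α y      ≡⟨ r+α≡k ⟩
    suc h ℕ.+ h         ∎)
    where open ℕ.≤-Reasoning

  ≈σα : ∀ y → y ≈ σ y ◃ α y [ k ]
  ≈σα y = congruent (quotient (σα-cases y))
    where
    open ≡-Reasoning
    r = y %ℕ k
    q = y /ℕ k
    eq₁ : ∀ a b → a + b - a ≡ b
    eq₁ = solve-∀
    eq₂ : ∀ a b c → a + b - (- c) ≡ (a + c) + b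
    eq₂ = solve-∀
    eq₃ : ∀ a b → a + b * a ≡ (1ℤ + b) * a
    eq₃ = solve-∀
    quotient : _ → + k ∣ y - (σ y ◃ α y)
    quotient (inj₁ (σ≡ , α≡ , _)) = divides q (begin
      y - (σ y ◃ α y)        ≡⟨ cong₂ _-_ (a≡a%ℕn+[a/ℕn]*n y k) (trans (cong₂ _◃_ σ≡ α≡) (ℤ.+◃n≡+n r)) ⟩
      + r + q * + k - + r    ≡⟨ eq₁ (+ r) (q * + k) ⟩
      q * + k                ∎)
    quotient (inj₂ (σ≡ , r+α≡ , _)) = divides (1ℤ + q) (begin
      y - (σ y ◃ α y)               ≡⟨ cong₂ _-_ (a≡a%ℕn+[a/ℕn]*n y k) (trans (cong (_◃ α y) σ≡) (ℤ.-◃n≡-n (α y))) ⟩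
      + r + q * + k - (- + α y)     ≡⟨ eq₂ (+ r) (q * + k) (+ α y) ⟩
      (+ r + + α y) + q * + k       ≡⟨ cong (_+ q * + k) (trans (sym (ℤ.pos-+ r (α y))) (cong +_ r+α≡)) ⟩
      + k + q * + k                 ≡⟨ eq₃ (+ k) q ⟩
      (1ℤ + q) * + k                ∎)

  α>0 : ∀ y → ¬ k ℕ.∣ ∣ y ∣ → 0 ℕ.< α y
  α>0 y k∤y = ℕ.n≢0⇒n>0 λ αy≡0 →
    k∤y (≈0⇒∣ (subst (λ a → y ≈ a [ k ]) (trans (cong (σ y ◃_) αy≡0) (s◃0 (σ y))) (≈σα y)))
    where
    s◃0 : ∀ s → s ◃ 0 ≡ 0ℤ
    s◃0 ⊕ = refl
    s◃0 ⊖ = refl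

  -- Both sides have absolute value at most h, so they differ by at most 2h < k.
  ◃-≈⇒≡ : ∀ {s t i j} → i ℕ.≤ h → j ℕ.≤ h → s ◃ i ≈ t ◃ j [ k ] → s ◃ i ≡ t ◃ j
  ◃-≈⇒≡ {s} {t} {i} {j} i≤h j≤h (congruent p) =
    ℤ.i-j≡0⇒i≡j _ _ (ℤ.∣i∣≡0⇒i≡0 (small (∣⇒∣ᵤ p) bound))
    where
    bound : ∣ (s ◃ i) - (t ◃ j) ∣ ℕ.< k
    bound = s≤s (begin
      ∣ (s ◃ i) - (t ◃ j) ∣         ≤⟨ ℤ.∣i-j∣≤∣i∣+∣j∣ (s ◃ i) (t ◃ j) ⟩
      ∣ s ◃ i ∣ ℕ.+ ∣ t ◃ j ∣       ≡⟨ cong₂ ℕ._+_ (ℤ.abs-◃ s i) (ℤ.abs-◃ t j) ⟩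
      i ℕ.+ j                       ≤⟨ ℕ.+-mono-≤ i≤h j≤h ⟩
      h ℕ.+ h                       ∎)
      where open ℕ.≤-Reasoning
    small : ∀ {n} → k ℕ.∣ n → n ℕ.< k → n ≡ 0
    small {zero}  _   _   = refl
    small {suc n} k∣n n<k = contradiction (ℕ.∣⇒≤ k∣n) (ℕ.<⇒≱ n<k)

  -- The bound `0 < j` is what fixes the sign: the residue 0 is represented with either one.
  σα-unique : ∀ y {s j} → 0 ℕ.< j → j ℕ.≤ h → y ≈ s ◃ j [ k ] → σ y ≡ s × α y ≡ j
  σα-unique y {s} {j} 0<j j≤h y≈ =
    [ (λ σ≡s → σ≡s , ℤ.abs-cong {σ y} {α y} {s} {j} eq)
    , (λ (_ , j≡0) → contradiction (sym j≡0) (ℕ.<⇒≢ 0<j))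
    ]′ (ℤ.sign-cong′ {σ y} {α y} {s} {j} eq)
    where
    eq : σ y ◃ α y ≡ s ◃ j
    eq = ◃-≈⇒≡ (α≤h y) j≤h (≈-trans (≈-sym (≈σα y)) y≈)

  σ-cong : ∀ {y z} → ¬ k ℕ.∣ ∣ z ∣ → y ≈ z [ k ] → σ y ≡ σ z
  σ-cong {y} {z} k∤z y≈z = proj₁ (σα-unique y (α>0 z k∤z) (α≤h z) (≈-trans y≈z (≈σα z)))

  CoprimeTo : ℤ → Set
  CoprimeTo x = Coprime ∣ x ∣ k

  H : List ℕ
  H = [1⋯ h ]

  i∤ : ∀ {i} → i ∈ H → ¬ k ℕ.∣ i
  i∤ i∈ k∣i with 0<i , i≤h ← ∈-[1⋯]⁻ i∈ =
    ℕ.<⇒≱ (s≤s (ℕ.≤-trans i≤h (ℕ.m≤m+n h h))) (ℕ.∣⇒≤ {{ℕ.>-nonZero 0<i}} k∣i)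

  x*i∤ : ∀ x {i} → CoprimeTo x → i ∈ H → ¬ k ℕ.∣ ∣ x * + i ∣
  x*i∤ x {i} cop i∈ k∣xi =
    i∤ i∈ (coprime-divisor (Coprime.sym cop) (subst (k ℕ.∣_) (ℤ.abs-* x (+ i)) k∣xi))

  *-cancelˡ-≈ : ∀ x → CoprimeTo x → ∀ {a b} → x * a ≈ x * b [ k ] → a ≈ b [ k ]
  *-cancelˡ-≈ x cop {a} {b} (congruent p) = congruent (∣ᵤ⇒∣ (coprime-divisor (Coprime.sym cop)
    (subst (k ℕ.∣_) (trans (cong ∣_∣ (eq x a b)) (ℤ.abs-* x (a - b))) (∣⇒∣ᵤ p))))
    where
    eq : ∀ x a b → x * a - x * b ≡ x * (a - b)
    eq = solve-∀

  ◃-as-* : ∀ s n → s ◃ n ≡ (s ◃ 1) * + n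
  ◃-as-* s n = begin
    s ◃ n                     ≡⟨ cong₂ _◃_ (sym (*-identityʳ s)) (sym (ℕ.*-identityˡ n)) ⟩
    (s · ⊕) ◃ (1 ℕ.* n)       ≡⟨ ℤ.◃-distrib-* s ⊕ 1 n ⟩
    (s ◃ 1) * (⊕ ◃ n)         ≡⟨ cong ((s ◃ 1) *_) (ℤ.+◃n≡+n n) ⟩
    (s ◃ 1) * + n             ∎
    where open ≡-Reasoning

  ·-◃ : ∀ s t n → (s · t) ◃ n ≡ (s ◃ 1) * (t ◃ n)
  ·-◃ s t n = trans (cong ((s · t) ◃_) (sym (ℕ.*-identityˡ n))) (ℤ.◃-distrib-* s t 1 n)

  -- With y i written as ± j and then x j as ± j′, the two signs multiply. This replaces Euler's
  -- criterion as the source of multiplicativity, so k may be composite.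
  σ-cocycle : ∀ x y {i} → CoprimeTo x → CoprimeTo y → i ∈ H →
              σ (x * y * + i) ≡ σ (y * + i) · σ (x * + α (y * + i))
  σ-cocycle x y {i} copx copy i∈ = proj₁ (σα-unique _ (α>0 (x * + j) (x*i∤ x copx j∈)) (α≤h (x * + j)) chain)
    where
    j = α (y * + i)
    s = σ (y * + i)
    j∈ : j ∈ H
    j∈ = ∈-[1⋯]⁺ (α>0 (y * + i) (x*i∤ y copy i∈)) (α≤h (y * + i))
    eq : ∀ x s j → x * (s * j) ≡ s * (x * j)
    eq = solve-∀
    chain : x * y * + i ≈ (s · σ (x * + j)) ◃ α (x * + j) [ k ]
    chain = ≈-trans (≈-reflexive (ℤ.*-assoc x y (+ i)))
           (≈-trans (≈-* (≈-reflexive {a = x} refl) (≈σα (y * + i)))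
           (≈-trans (≈-reflexive (trans (cong (x *_) (◃-as-* s j)) (eq x (s ◃ 1) (+ j))))
           (≈-trans (≈-* (≈-reflexive {a = s ◃ 1} refl) (≈σα (x * + j)))
           (≈-reflexive (sym (·-◃ s (σ (x * + j)) (α (x * + j))))))))

  -- Equal absolute residues of x i and x j give x i ≡ ± x j; then x cancels, and i ≡ ± j inside `H`
  -- forces i = j.
  α-permutes : ∀ x → CoprimeTo x → map (λ i → α (x * + i)) H ↭ H
  α-permutes x cop = map-↭ _ ([1⋯]-unique h)
    (λ {i} i∈ → ∈-[1⋯]⁺ (α>0 (x * + i) (x*i∤ x cop i∈)) (α≤h (x * + i)))
    inj
    where
    inj : ∀ {i j} → i ∈ H → j ∈ H → α (x * + i) ≡ α (x * + j) → i ≡ j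
    inj {i} {j} i∈ j∈ αi≡αj = ℤ.abs-cong {s = ⊕} {t = s · t} (◃-≈⇒≡ (proj₂ (∈-[1⋯]⁻ i∈)) (proj₂ (∈-[1⋯]⁻ j∈))
        (≈-trans (≈-reflexive (ℤ.+◃n≡+n i)) (*-cancelˡ-≈ x cop chain)))
      where
      s = σ (x * + i)
      t = σ (x * + j)
      a = α (x * + j)
      eq : ∀ x u j → u * (x * j) ≡ x * (u * j)
      eq = solve-∀
      st : ∀ s t → s ≡ s · t · t
      st s t = sym (trans (*-assoc s t t) (trans (cong (s ·_) (s*s≡+ t)) (*-identityʳ s)))
      chain : x * + i ≈ x * ((s · t) ◃ j) [ k ]
      chain = ≈-trans (≈σα (x * + i))
             (≈-trans (≈-reflexive (trans (cong₂ _◃_ (st s t) αi≡αj) (·-◃ (s · t) t a)))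
             (≈-trans (≈-* (≈-reflexive {a = (s · t) ◃ 1} refl) (≈-sym (≈σα (x * + j))))
             (≈-reflexive (trans (eq x ((s · t) ◃ 1) (+ j)) (cong (x *_) (sym (◃-as-* (s · t) j)))))))

  jacobi : ℤ → Sign
  jacobi x = ∏ (λ i → σ (x * + i)) H

  -- The second factor supplied by `σ-cocycle` is a sign of x at a relabelled index, and the
  -- relabelling by y permutes `H`.
  jacobi-* : ∀ x y → CoprimeTo x → CoprimeTo y → jacobi (x * y) ≡ jacobi x · jacobi y
  jacobi-* x y copx copy = begin
    ∏ (λ i → σ (x * y * + i)) H                                   ≡⟨ ∏-cong H (σ-cocycle x y copx copy) ⟩
    ∏ (λ i → σ (y * + i) · σ (x * + α (y * + i))) H               ≡⟨ ∏-· (λ i → σ (y * + i)) (λ i → σ (x * + α (y * + i))) H ⟩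
    jacobi y · ∏ (λ i → σ (x * + α (y * + i))) H                  ≡⟨ cong (jacobi y ·_) (sym (∏-map (λ j → σ (x * + j)) (λ i → α (y * + i)) H)) ⟩
    jacobi y · ∏ (λ j → σ (x * + j)) (map (λ i → α (y * + i)) H)  ≡⟨ cong (jacobi y ·_) (∏-↭ _ (α-permutes y copy)) ⟩
    jacobi y · jacobi x                                           ≡⟨ *-comm (jacobi y) (jacobi x) ⟩
    jacobi x · jacobi y                                           ∎
    where open ≡-Reasoning

  jacobi-cong : ∀ x y → CoprimeTo y → x ≈ y [ k ] → jacobi x ≡ jacobi y
  jacobi-cong x y cop x≈y = ∏-cong H λ {i} i∈ →
    σ-cong (x*i∤ y cop i∈) (≈-* x≈y (≈-reflexive {a = + i} refl))

  -- The congruences x i ≡ ± α (x i) are multiplied over `H`. The absolute residues are 1, ..., h in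
  -- another order, so h! appears on both sides.
  gauss : ∀ x → CoprimeTo x → x ^ h * + product H ≈ jacobi x ◃ product H [ k ]
  gauss x cop = subst₂ (λ l P → x ^ l * + product H ≈ jacobi x ◃ P [ k ]) (length-applyUpTo suc h)
    (product-↭ (α-permutes x cop)) (go H)
    where
    go : ∀ is → x ^ length is * + product is ≈ ∏ (λ i → σ (x * + i)) is ◃ product (map (λ i → α (x * + i)) is) [ k ]
    go [] = ≈-reflexive refl
    go (i ∷ is) = ≈-trans (≈-reflexive (trans (cong (x ^ suc (length is) *_) (ℤ.pos-* i (product is))) (eq x (x ^ length is) (+ i) (+ product is))))
      (≈-trans (≈-* (≈σα (x * + i)) (go is)) (≈-reflexive (sym (ℤ.◃-distrib-* (σ (x * + i)) _ (α (x * + i)) _))))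
      where
      eq : ∀ x y i p → x * y * (i * p) ≡ (x * i) * (y * p)
      eq = solve-∀

  σ-neg : ∀ y → ¬ k ℕ.∣ ∣ y ∣ → σ (- y) ≡ opposite (σ y)
  σ-neg y k∤y = proj₁ (σα-unique (- y) (α>0 y k∤y) (α≤h y)
    (≈-trans (≈-reflexive (sym (ℤ.-1*i≡-i y))) (≈-trans (≈-* (≈-reflexive {a = ℤ.-1ℤ} refl) (≈σα y))
     (≈-reflexive (trans (sym (·-◃ ⊖ (σ y) (α y))) (cong (_◃ α y) (opposite-·ˡ ⊕ (σ y))))))))

  -- All h signs flip, and `parity h ≡ ⊕` amounts to k ≡ 1 modulo 4.
  jacobi-neg : ∀ x → parity h ≡ ⊕ → CoprimeTo x → jacobi (- x) ≡ jacobi x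
  jacobi-neg x even cop = begin
    ∏ (λ i → σ (- x * + i)) H            ≡⟨ ∏-cong H (λ {i} i∈ → trans (cong σ (sym (ℤ.neg-distribˡ-* x (+ i))))
                                             (trans (σ-neg (x * + i) (x*i∤ x cop i∈)) (sym (opposite-·ˡ ⊕ _)))) ⟩
    ∏ (λ i → ⊖ · σ (x * + i)) H          ≡⟨ ∏-· (λ _ → ⊖) (λ i → σ (x * + i)) H ⟩
    ∏ (λ _ → ⊖) H · jacobi x             ≡⟨ cong (_· jacobi x) (∏-const-even ⊖ H (trans (cong parity (length-applyUpTo suc h)) even)) ⟩
    jacobi x                             ∎
    where open ≡-Reasoning

-- Eisenstein's lattice points, the symbol of 2 and reciprocity

parity-odd-* : ∀ h n → parity (suc (h ℕ.+ h) ℕ.* n) ≡ parity n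
parity-odd-* h n = begin
  parity (n ℕ.+ (h ℕ.+ h) ℕ.* n)            ≡⟨ parity-+ n ((h ℕ.+ h) ℕ.* n) ⟩
  parity n · parity ((h ℕ.+ h) ℕ.* n)       ≡⟨ cong (λ m → parity n · parity m) (ℕ.*-distribʳ-+ n h h) ⟩
  parity n · parity (h ℕ.* n ℕ.+ h ℕ.* n)   ≡⟨ cong (parity n ·_) (parity-double (h ℕ.* n)) ⟩
  parity n · ⊕                              ≡⟨ *-identityʳ (parity n) ⟩
  parity n                                  ∎
  where open ≡-Reasoning

s·t≡⊕⇒s≡t : ∀ s t → s · t ≡ ⊕ → s ≡ t
s·t≡⊕⇒s≡t ⊕ ⊕ _ = refl
s·t≡⊕⇒s≡t ⊖ ⊖ _ = refl

negIf : ∀ {P : Set} → Dec P → Sign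
negIf (yes _) = ⊖
negIf (no  _) = ⊕

negIf-yes : ∀ {P : Set} (d : Dec P) → P → negIf d ≡ ⊖
negIf-yes (yes _) _ = refl
negIf-yes (no ¬p) p = contradiction p ¬p

negIf-no : ∀ {P : Set} (d : Dec P) → ¬ P → negIf d ≡ ⊕
negIf-no (yes p) ¬p = contradiction p ¬p
negIf-no (no _)  _  = refl

module _ (h : ℕ) where
  open Residue h

  -- When the sign is negative, r + α = k is odd, so r and α differ in parity; otherwise they are
  -- equal.
  parity-residue : ∀ n → σ (+ n) · parity (α (+ n)) ≡ parity (n ℕ.% k)
  parity-residue n with σα-cases (+ n)
  ... | inj₁ (σ≡ , α≡ , _) = cong₂ _·_ σ≡ (cong parity α≡)
  ... | inj₂ (σ≡ , r+α≡ , _) = trans (cong (_· parity (α (+ n))) σ≡) (lem _ _ (begin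
    parity (n ℕ.% k) · parity (α (+ n))  ≡⟨ sym (parity-+ (n ℕ.% k) (α (+ n))) ⟩
    parity (n ℕ.% k ℕ.+ α (+ n))         ≡⟨ cong parity r+α≡ ⟩
    opposite (parity (h ℕ.+ h))          ≡⟨ cong opposite (parity-double h) ⟩
    ⊖                                    ∎))
    where
    open ≡-Reasoning
    lem : ∀ s t → s · t ≡ ⊖ → ⊖ · t ≡ s
    lem ⊕ ⊖ _ = refl
    lem ⊖ ⊕ _ = refl

  parity-quotient : ∀ n → σ (+ n) · parity (α (+ n)) · parity (n ℕ./ k) ≡ parity n
  parity-quotient n = begin
    σ (+ n) · parity (α (+ n)) · parity (n ℕ./ k)  ≡⟨ cong₂ _·_ (parity-residue n) (sym (parity-odd-* h (n ℕ./ k))) ⟩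
    parity (n ℕ.% k) · parity (k ℕ.* (n ℕ./ k))    ≡⟨ sym (parity-+ (n ℕ.% k) _) ⟩
    parity (n ℕ.% k ℕ.+ k ℕ.* (n ℕ./ k))           ≡⟨ cong (λ m → parity (n ℕ.% k ℕ.+ m)) (ℕ.*-comm k (n ℕ./ k)) ⟩
    parity (n ℕ.% k ℕ.+ n ℕ./ k ℕ.* k)             ≡⟨ cong parity (sym (ℕ.m≡m%n+[m/n]*n n k)) ⟩
    parity n                                       ∎
    where open ≡-Reasoning

  -- Eisenstein's form of Gauss's lemma: for odd x, the permuted residues and the
  -- original ones have the same total parity, so only the quotients matter.
  eisenstein : ∀ g → let x = suc (g ℕ.+ g) in Coprime x k →
               jacobi (+ x) ≡ ∏ (λ i → parity (x ℕ.* i ℕ./ k)) H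
  eisenstein g cop = lem (jacobi (+ x)) (∏ parity H) _ (begin
    jacobi (+ x) · ∏ parity H · ∏ f H                            ≡⟨ cong (λ s → jacobi (+ x) · s · ∏ f H) (sym perm) ⟩
    jacobi (+ x) · ∏ (λ i → parity (a i)) H · ∏ f H              ≡⟨ cong (_· ∏ f H) (sym (∏-· (λ i → σ (+ x * + i)) (λ i → parity (a i)) H)) ⟩
    ∏ (λ i → σ (+ x * + i) · parity (a i)) H · ∏ f H             ≡⟨ sym (∏-· (λ i → σ (+ x * + i) · parity (a i)) f H) ⟩
    ∏ (λ i → σ (+ x * + i) · parity (a i) · f i) H               ≡⟨ ∏-cong H (λ {i} _ → term i) ⟩
    ∏ parity H                                                   ∎)
    where
    open ≡-Reasoning
    x = suc (g ℕ.+ g)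
    a : ℕ → ℕ
    a i = α (+ x * + i)
    f : ℕ → Sign
    f i = parity (x ℕ.* i ℕ./ k)
    perm : ∏ (λ i → parity (a i)) H ≡ ∏ parity H
    perm = trans (sym (∏-map parity a H)) (∏-↭ parity (α-permutes (+ x) cop))
    term : ∀ i → σ (+ x * + i) · parity (a i) · f i ≡ parity i
    -- Since x is odd, x i has the parity of i.
    term i = trans (cong (λ y → σ y · parity (α y) · f i) (sym (ℤ.pos-* x i)))
      (trans (parity-quotient (x ℕ.* i)) (parity-odd-* g i))
    lem : ∀ s t u → s · t · u ≡ t → s ≡ u
    lem s t u eq = s·t≡⊕⇒s≡t s u (*-cancelʳ-≡ t (s · u) ⊕ (trans (*-assoc s u t)
      (trans (cong (s ·_) (*-comm u t)) (trans (sym (*-assoc s t u)) eq))))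

  -- The parity of a quotient counts lattice points below the line k j = x i.
  parity-count : ∀ n g → n ℕ./ k ℕ.≤ g → parity (n ℕ./ k) ≡ ∏ (λ j → negIf (j ℕ.* k ℕ.≤? n)) [1⋯ g ]
  parity-count n g q≤g = sym (trans
    (∏-indicator (λ j → negIf (j ℕ.* k ℕ.≤? n)) [1⋯ n ℕ./ k ] ([1⋯]-unique _) ([1⋯]-unique g)
      (λ j∈ → let 0<j , j≤q = ∈-[1⋯]⁻ j∈ in ∈-[1⋯]⁺ 0<j (ℕ.≤-trans j≤q q≤g))
      (λ _ j∈ → negIf-yes (_ ℕ.≤? n) (ℕ.≤-trans (ℕ.*-monoˡ-≤ k (proj₂ (∈-[1⋯]⁻ j∈))) (ℕ.m/n*n≤m n k)))
      (λ {j} j∈ j∉ → negIf-no (_ ℕ.≤? n) λ jk≤n → j∉ (∈-[1⋯]⁺ (proj₁ (∈-[1⋯]⁻ j∈))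
        (subst (ℕ._≤ n ℕ./ k) (ℕ.m*n/n≡m j k) (ℕ./-monoˡ-≤ k jk≤n)))))
    (cong parity (length-applyUpTo suc (n ℕ./ k))))

  jacobi-count : ∀ g → let x = suc (g ℕ.+ g) in Coprime x k →
                 jacobi (+ x) ≡ ∏ (λ i → ∏ (λ j → negIf (j ℕ.* k ℕ.≤? x ℕ.* i)) [1⋯ g ]) H
  jacobi-count g cop = trans (eisenstein g cop) (∏-cong H λ {i} i∈ →
    -- Each quotient is at most g because x i ≤ (2g+1) h < (g+1)(2h+1); all counted points therefore
    -- lie in the h by g rectangle.
    parity-count (x ℕ.* i) g (ℕ.≤-pred (ℕ.m<n*o⇒m/o<n {n = suc g} (begin-strict
      x ℕ.* i                  ≤⟨ ℕ.*-monoʳ-≤ x (proj₂ (∈-[1⋯]⁻ i∈)) ⟩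
      x ℕ.* h                  <⟨ s≤s (ℕ.m≤m+n _ (h ℕ.+ g)) ⟩
      suc (x ℕ.* h ℕ.+ (h ℕ.+ g))  ≡⟨ eq g h ⟩
      suc g ℕ.* k              ∎))))
    where
    open ℕ.≤-Reasoning
    x = suc (g ℕ.+ g)
    eq : ∀ g h → suc (suc (g ℕ.+ g) ℕ.* h ℕ.+ (h ℕ.+ g)) ≡ suc g ℕ.* suc (h ℕ.+ h)
    eq = ℕSolver.solve-∀

  -- For h = 2t the product 2i stays at most h exactly when i ≤ t. To count over the initial segment
  -- [1⋯ t ] all h signs are flipped first, which changes nothing because h is even.
  jacobi-two : ∀ t → h ≡ t ℕ.+ t → jacobi (+ 2) ≡ parity t
  jacobi-two t refl = begin
    jacobi (+ 2)                                ≡⟨ cong (_· jacobi (+ 2)) (sym ∏⊖≡⊕) ⟩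
    ∏ (λ _ → ⊖) H · jacobi (+ 2)                ≡⟨ sym (∏-· (λ _ → ⊖) (λ i → σ (+ 2 * + i)) H) ⟩
    ∏ (λ i → ⊖ · σ (+ 2 * + i)) H               ≡⟨ ∏-indicator _ [1⋯ t ] ([1⋯]-unique t) ([1⋯]-unique h)
                                                     (λ i∈ → let 0<i , i≤t = ∈-[1⋯]⁻ i∈ in ∈-[1⋯]⁺ 0<i (ℕ.≤-trans i≤t (ℕ.m≤m+n t t)))
                                                     neg pos ⟩
    parity (length [1⋯ t ])                     ≡⟨ cong parity (length-applyUpTo suc t) ⟩
    parity t                                    ∎
    where
    open ≡-Reasoning
    ∏⊖≡⊕ : ∏ (λ _ → ⊖) H ≡ ⊕
    ∏⊖≡⊕ = ∏-const-even ⊖ H (trans (cong parity (length-applyUpTo suc h)) (parity-double t))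
    2i%k : ∀ {i} → i ∈ H → (2 ℕ.* i) ℕ.% k ≡ i ℕ.+ i
    2i%k {i} i∈ = trans (ℕ.m<n⇒m%n≡m (s≤s (subst (ℕ._≤ h ℕ.+ h) (cong (i ℕ.+_) (sym (ℕ.+-identityʳ i)))
      (ℕ.+-mono-≤ i≤h i≤h)))) (cong (i ℕ.+_) (ℕ.+-identityʳ i))
      where i≤h = proj₂ (∈-[1⋯]⁻ i∈)
    neg : ∀ {i} → i ∈ H → i ∈ [1⋯ t ] → ⊖ · σ (+ 2 * + i) ≡ ⊖
    neg {i} i∈ i∈t rewrite sym (ℤ.pos-* 2 i) with σα-cases (+ (2 ℕ.* i))
    ... | inj₁ (σ≡ , _) = cong (⊖ ·_) σ≡
    ... | inj₂ (_ , _ , h<r) = contradiction (subst (h ℕ.<_) (2i%k i∈) h<r) (ℕ.≤⇒≯ (ℕ.+-mono-≤ i≤t i≤t))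
      where i≤t = proj₂ (∈-[1⋯]⁻ i∈t)
    pos : ∀ {i} → i ∈ H → i ∉ [1⋯ t ] → ⊖ · σ (+ 2 * + i) ≡ ⊕
    pos {i} i∈ i∉t rewrite sym (ℤ.pos-* 2 i) with σα-cases (+ (2 ℕ.* i))
    ... | inj₂ (σ≡ , _) = cong (⊖ ·_) σ≡
    ... | inj₁ (_ , _ , r≤h) = contradiction (subst (ℕ._≤ h) (2i%k i∈) r≤h) (ℕ.<⇒≱ (ℕ.+-mono-< t<i t<i))
      where
      t<i : t ℕ.< i
      t<i = ℕ.≰⇒> λ i≤t → i∉t (∈-[1⋯]⁺ (proj₁ (∈-[1⋯]⁻ i∈)) i≤t)

-- Every point of the h by g rectangle lies on exactly one side of the diagonal k j = x i, so the
-- two counts add up to h g, which is even.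
jacobi-reciprocity : ∀ h g → parity h ≡ ⊕ → Coprime (suc (g ℕ.+ g)) (suc (h ℕ.+ h)) →
  Residue.jacobi h (+ suc (g ℕ.+ g)) ≡ Residue.jacobi g (+ suc (h ℕ.+ h))
jacobi-reciprocity h g even cop = s·t≡⊕⇒s≡t _ _ (begin
  Residue.jacobi h (+ x) · Residue.jacobi g (+ k)
    ≡⟨ cong₂ _·_ (jacobi-count h g cop) (trans (jacobi-count g h (Coprime.sym cop)) (∏-swap _ [1⋯ g ] [1⋯ h ])) ⟩
  ∏ (λ i → ∏ (λ j → below i j) [1⋯ g ]) [1⋯ h ] · ∏ (λ i → ∏ (λ j → above i j) [1⋯ g ]) [1⋯ h ]
    ≡⟨ sym (∏-· _ _ [1⋯ h ]) ⟩
  ∏ (λ i → ∏ (λ j → below i j) [1⋯ g ] · ∏ (λ j → above i j) [1⋯ g ]) [1⋯ h ]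
    ≡⟨ ∏-cong [1⋯ h ] (λ {i} i∈ → trans (sym (∏-· (below i) (above i) [1⋯ g ])) (∏-cong [1⋯ g ] (λ {j} _ → exclusive i j i∈))) ⟩
  ∏ (λ i → ∏ (λ j → ⊖) [1⋯ g ]) [1⋯ h ]
    ≡⟨ ∏-const-even _ [1⋯ h ] (trans (cong parity (length-applyUpTo suc h)) even) ⟩
  ⊕ ∎)
  where
  open ≡-Reasoning
  k = suc (h ℕ.+ h)
  x = suc (g ℕ.+ g)
  below above : ℕ → ℕ → Sign
  below i j = negIf (j ℕ.* k ℕ.≤? x ℕ.* i)
  above i j = negIf (i ℕ.* x ℕ.≤? k ℕ.* j)
  exclusive : ∀ i j → i ∈ [1⋯ h ] → below i j · above i j ≡ ⊖
  exclusive i j i∈ with j ℕ.* k ℕ.≤? x ℕ.* i | i ℕ.* x ℕ.≤? k ℕ.* j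
  ... | yes _  | no  _  = refl
  ... | no  _  | yes _  = refl
  -- A point on the diagonal would give k ∣ x i, hence k ∣ i, impossible for 1 ≤ i ≤ h.
  ... | yes jk≤ | yes ix≤ = contradiction (coprime-divisor (Coprime.sym cop) (ℕ.divides j
    (ℕ.≤-antisym (subst₂ ℕ._≤_ (ℕ.*-comm i x) (ℕ.*-comm k j) ix≤) jk≤))) (Residue.i∤ h i∈)
  ... | no jk≰ | no ix≰ = contradiction (ℕ.≰⇒> ix≰) (ℕ.<-asym (subst₂ ℕ._<_ (ℕ.*-comm x i) (ℕ.*-comm j k) (ℕ.≰⇒> jk≰)))

coprime-* : ∀ {a b k} → Coprime a k → Coprime b k → Coprime (a ℕ.* b) k
coprime-* {a} {b} a⊥k b⊥k {d} (d∣ab , d∣k) = b⊥k (coprime-divisor d⊥a d∣ab , d∣k)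
  where
  d⊥a : Coprime d a
  d⊥a (e∣d , e∣a) = a⊥k (e∣a , ℕ.∣-trans e∣d d∣k)

-- Roots of monic polynomials modulo a prime

-- The list c₀ ∷ … ∷ cₙ₋₁ ∷ [] stands for the monic polynomial c₀ + … + cₙ₋₁ Xⁿ⁻¹ + Xⁿ.
eval : List ℤ → ℤ → ℤ
eval []       x = 1ℤ
eval (c ∷ cs) x = c + x * eval cs x

-- Horner's scheme for the quotient by X - a: its coefficients are the values at a of the successive
-- tails. A linear polynomial has quotient 1, which is encoded by `[]`; the result on `[]` is a mere
-- default.
divide : ℤ → List ℤ → List ℤ
divide a (c ∷ cs@(_ ∷ _)) = eval cs a ∷ divide a cs
divide a _                = []

eval-divide : ∀ a c cs x → eval (c ∷ cs) x - eval (c ∷ cs) a ≡ (x - a) * eval (divide a (c ∷ cs)) x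
eval-divide a c [] x = eq a c x
  where
  eq : ∀ a c x → (c + x * 1ℤ) - (c + a * 1ℤ) ≡ (x - a) * 1ℤ
  eq = solve-∀
eval-divide a c cs@(c′ ∷ cs′) x = begin
  (c + x * eval cs x) - (c + a * eval cs a)
    ≡⟨ eq₁ a c x (eval cs x) (eval cs a) ⟩
  x * (eval cs x - eval cs a) + (x - a) * eval cs a
    ≡⟨ cong (λ e → x * e + (x - a) * eval cs a) (eval-divide a c′ cs′ x) ⟩
  x * ((x - a) * eval (divide a cs) x) + (x - a) * eval cs a
    ≡⟨ eq₂ a x (eval cs a) (eval (divide a cs) x) ⟩
  (x - a) * (eval cs a + x * eval (divide a cs) x) ∎
  where
  open ≡-Reasoning
  eq₁ : ∀ a c x u v → (c + x * u) - (c + a * v) ≡ x * (u - v) + (x - a) * v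
  eq₁ = solve-∀
  eq₂ : ∀ a x v w → x * ((x - a) * w) + (x - a) * v ≡ (x - a) * (v + x * w)
  eq₂ = solve-∀

length-divide : ∀ a c cs → length (divide a (c ∷ cs)) ≡ length cs
length-divide a c []         = refl
length-divide a c (c′ ∷ cs)  = cong suc (length-divide a c′ cs)

*-≈0 : ∀ {p} a b → Prime p → a * b ≈ 0ℤ [ p ] → a ≈ 0ℤ [ p ] ⊎ b ≈ 0ℤ [ p ]
*-≈0 {p} a b pp ab≈0 = Sum.map ∣⇒≈0 ∣⇒≈0
  (euclidsLemma ∣ a ∣ ∣ b ∣ pp (subst (p ℕ.∣_) (ℤ.abs-* a b) (≈0⇒∣ ab≈0)))

-≈0⇒≈ : ∀ {k a b} → a - b ≈ 0ℤ [ k ] → a ≈ b [ k ]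
-≈0⇒≈ {k} {a} {b} (congruent p) = congruent (subst (+ k ∣_) (ℤ.+-identityʳ (a - b)) p)

≈⇒-≈0 : ∀ {k a b} → a ≈ b [ k ] → a - b ≈ 0ℤ [ k ]
≈⇒-≈0 {k} {a} {b} (congruent p) = congruent (subst (+ k ∣_) (sym (ℤ.+-identityʳ (a - b))) p)

-- One root r splits off a factor X - r. The other roots are incongruent to r, so primality makes
-- them roots of the quotient, of degree one less; in degree 0 the polynomial is 1 and has no root.
lagrange : ∀ {p} → Prime p → ∀ n cs rs → length cs ≡ n → length rs ≡ suc n →
           AllPairs (λ a b → ¬ b ≈ a [ p ]) rs → ¬ All (λ r → eval cs r ≈ 0ℤ [ p ]) rs
lagrange pp zero [] (r ∷ _) _ _ _ (1≈0 ∷ _) = ¬prime[1] (subst Prime (ℕ.∣1⇒≡1 (≈0⇒∣ 1≈0)) pp)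
lagrange {p} pp (suc n) (c ∷ cs) (r ∷ rs) lcs lrs (r≉ ∷ distinct) (r≈ ∷ rs≈) =
  lagrange pp n (divide r (c ∷ cs)) rs (trans (length-divide r c cs) (ℕ.suc-injective lcs))
    (ℕ.suc-injective lrs) distinct (All.zipWith root (r≉ , rs≈))
  where
  root : ∀ {b} → (¬ b ≈ r [ p ]) × eval (c ∷ cs) b ≈ 0ℤ [ p ] → eval (divide r (c ∷ cs)) b ≈ 0ℤ [ p ]
  root {b} (b≉r , b≈) = [ (λ b-r≈0 → contradiction (-≈0⇒≈ b-r≈0) b≉r) , id ]′
    (*-≈0 (b - r) (eval (divide r (c ∷ cs)) b) pp
      (≈-trans (≈-reflexive (sym (eval-divide r c cs b))) (≈⇒-≈0 (≈-trans b≈ (≈-sym r≈)))))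

-- Sign count and squares modulo a prime

module _ (h : ℕ) (pp : Prime (suc (h ℕ.+ h))) where
  open Residue h

  coprime-∈H : ∀ {i} → i ∈ H → Coprime i k
  coprime-∈H i∈ with 0<i , i≤h ← ∈-[1⋯]⁻ i∈ =
    Coprime.sym (prime⇒coprime pp {{ℕ.>-nonZero 0<i}} (s≤s (ℕ.≤-trans i≤h (ℕ.m≤m+n h h))))

  -- Needed to cancel h! from `gauss`; all its factors are positive and below the prime k.
  coprime-product-H : Coprime (product H) k
  coprime-product-H = go H coprime-∈H
    where
    go : ∀ is → (∀ {i} → i ∈ is → Coprime i k) → Coprime (product is) k
    go []       _   = Coprime.1-coprimeTo k
    go (i ∷ is) cop = coprime-* {i} (cop (here refl)) (go is (cop ∘ there))

  jacobi⊕⇒power≈1 : ∀ x → CoprimeTo x → jacobi x ≡ ⊕ → x ^ h ≈ 1ℤ [ k ]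
  jacobi⊕⇒power≈1 x cop J≡⊕ = *-cancelˡ-≈ (+ P) coprime-product-H
    (≈-trans (≈-reflexive (ℤ.*-comm (+ P) (x ^ h)))
    (≈-trans (gauss x cop)
    (≈-reflexive (trans (cong (_◃ P) J≡⊕) (trans (ℤ.+◃n≡+n P) (sym (ℤ.*-identityʳ (+ P))))))))
    where P = product H

  -- The h squares are roots of X^h − 1, so no nonsquare is.
  jacobi⊕⇒square : ∀ x → CoprimeTo x → jacobi x ≡ ⊕ → ¬ ¬ (∃ λ y → (+ k) Unsigned.∣ (y * y - x))
  jacobi⊕⇒square x cop J≡⊕ nonsquare =
    -- With `x` put before the squares of 1, ..., h there are h + 1 roots in degree h. The
    -- assumption `nonsquare` is what separates `x` from the squares.
    lagrange pp h (coefficients h) (x ∷ map square H) (length-coefficients h 0<h)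
      (cong suc (trans (length-map square H) (length-applyUpTo suc h)))
      (All.map⁺ (All.tabulate λ {i} _ i²≈x → nonsquare (+ i , ∣⇒∣ᵤ (_≈_[_].difference i²≈x))) ∷
       AllPairs.map⁺ (pairs H id ([1⋯]-unique h)))
      (root x (jacobi⊕⇒power≈1 x cop J≡⊕) ∷ All.map⁺ (All.tabulate λ {i} i∈ → root (square i)
        (jacobi⊕⇒power≈1 (square i) (subst (λ n → Coprime n k) (sym (ℤ.abs-* (+ i) (+ i))) (coprime-* {i} (coprime-∈H i∈) (coprime-∈H i∈)))
          (trans (jacobi-* (+ i) (+ i) (coprime-∈H i∈) (coprime-∈H i∈)) (s*s≡+ (jacobi (+ i)))))))
    where
    square : ℕ → ℤ
    square i = + i * + i
    -- Encodes X^n - 1 for n > 0, the leading 1 being implicit; the value at 0 is a default,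
    -- excluded by `0<h`.
    coefficients : ℕ → List ℤ
    coefficients zero    = []
    coefficients (suc n) = - 1ℤ ∷ replicate n 0ℤ
    length-coefficients : ∀ n → 0 ℕ.< n → length (coefficients n) ≡ n
    length-coefficients (suc n) _ = cong suc (length-replicate n)
    0<h : 0 ℕ.< h
    0<h = ℕ.n≢0⇒n>0 λ h≡0 → ¬prime[1] (subst (λ h → Prime (suc (h ℕ.+ h))) h≡0 pp)
    eval-zeros : ∀ n y → eval (replicate n 0ℤ) y ≡ y ^ n
    eval-zeros zero    y = refl
    eval-zeros (suc n) y = trans (ℤ.+-identityˡ _) (cong (y *_) (eval-zeros n y))
    eval-coefficients : ∀ n y → 0 ℕ.< n → eval (coefficients n) y ≡ y ^ n - 1ℤ
    eval-coefficients (suc n) y _ = trans (ℤ.+-comm (- 1ℤ) (y * eval (replicate n 0ℤ) y)) (cong (λ e → y * e - 1ℤ) (eval-zeros n y))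
    root : ∀ y → y ^ h ≈ 1ℤ [ k ] → eval (coefficients h) y ≈ 0ℤ [ k ]
    root y (congruent p) = congruent (subst (+ k ∣_) (trans (sym (eval-coefficients h y 0<h)) (sym (ℤ.+-identityʳ _))) p)
    -- From j² ≡ i² primality gives j ≡ ± i, and two numbers in `H` congruent up to sign are equal.
    distinct : ∀ {i j} → i ∈ H → j ∈ H → square j ≈ square i [ k ] → i ≡ j
    distinct {i} {j} i∈ j∈ j²≈i² = [ same ⊕ ∘ subst (λ a → + j ≈ a [ k ]) (sym (ℤ.+◃n≡+n i)) ∘ -≈0⇒≈
                                   , same ⊖ ∘ subst (λ a → + j ≈ a [ k ]) (sym (ℤ.-◃n≡-n i)) ∘ +≈0⇒≈ ]′
      (*-≈0 (+ j - + i) (+ j + + i) pp (≈-trans (≈-reflexive (eq (+ j) (+ i))) (≈⇒-≈0 j²≈i²)))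
      where
      eq : ∀ a b → (a - b) * (a + b) ≡ a * a - b * b
      eq = solve-∀
      same : ∀ s → + j ≈ s ◃ i [ k ] → i ≡ j
      same s j≈si = sym (ℤ.abs-cong {⊕} {j} {s} {i} (◃-≈⇒≡ (proj₂ (∈-[1⋯]⁻ j∈)) (proj₂ (∈-[1⋯]⁻ i∈))
        (subst (λ a → a ≈ s ◃ i [ k ]) (sym (ℤ.+◃n≡+n j)) j≈si)))
      +≈0⇒≈ : + j + + i ≈ 0ℤ [ k ] → + j ≈ - + i [ k ]
      +≈0⇒≈ j+i≈0 = -≈0⇒≈ (≈-trans (≈-reflexive (cong (λ a → + j + a) (ℤ.neg-involutive (+ i)))) j+i≈0)
    pairs : ∀ is → (∀ {i} → i ∈ is → i ∈ H) → AllPairs (λ i j → ¬ i ≡ j) is →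
            AllPairs (λ i j → ¬ square j ≈ square i [ k ]) is
    pairs []       sub []        = []
    pairs (i ∷ is) sub (i≢ ∷ u)  =
      All.tabulate (λ j∈ j²≈i² → All.lookup i≢ j∈ (distinct (sub (here refl)) (sub (there j∈)) j²≈i²)) ∷
      pairs is (sub ∘ there) u

-- The Jacobi symbol as a function of numerator and modulus

Odd : ℕ → Set
Odd k = ∃ λ h → k ≡ suc (h ℕ.+ h)

-- Spelled so that k is literally `suc (h + h)` with h = t + t; the evenness of h that reciprocity
-- asks for is then `parity-double t`.
OneMod4 : ℕ → Set
OneMod4 k = ∃ λ t → k ≡ suc ((t ℕ.+ t) ℕ.+ (t ℕ.+ t))

oneMod4⇒odd : ∀ {k} → OneMod4 k → Odd k
oneMod4⇒odd (t , eq) = t ℕ.+ t , eq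

oneMod4-* : ∀ {a b} → OneMod4 a → OneMod4 b → OneMod4 (a ℕ.* b)
oneMod4-* (s , refl) (t , refl) = s ℕ.+ t ℕ.+ 4 ℕ.* (s ℕ.* t) , eq s t
  where
  eq : ∀ s t → suc ((s ℕ.+ s) ℕ.+ (s ℕ.+ s)) ℕ.* suc ((t ℕ.+ t) ℕ.+ (t ℕ.+ t)) ≡
       suc (((s ℕ.+ t ℕ.+ 4 ℕ.* (s ℕ.* t)) ℕ.+ (s ℕ.+ t ℕ.+ 4 ℕ.* (s ℕ.* t))) ℕ.+
            ((s ℕ.+ t ℕ.+ 4 ℕ.* (s ℕ.* t)) ℕ.+ (s ℕ.+ t ℕ.+ 4 ℕ.* (s ℕ.* t))))
  eq = ℕSolver.solve-∀

even⊎odd : ∀ n → (∃ λ h → n ≡ h ℕ.+ h) ⊎ Odd n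
even⊎odd zero = inj₁ (0 , refl)
even⊎odd (suc n) with even⊎odd n
... | inj₁ (h , refl) = inj₂ (h , refl)
... | inj₂ (h , refl) = inj₁ (suc h , cong suc (sym (ℕ.+-suc h h)))

-- The Jacobi symbol (x/k), meaningful for odd k coprime to x.
J : ℤ → ℕ → Sign
J x k = Residue.jacobi ⌊ k /2⌋ x

J-odd : ∀ x h → J x (suc (h ℕ.+ h)) ≡ Residue.jacobi h x
-- The floor of (h + h + 1)/2 is by definition the ceiling of (h + h)/2, hence the lemma on
-- ceilings.
J-odd x h = cong (λ g → Residue.jacobi g x) (sym (ℕ.n≡⌈n+n/2⌉ h))

J-* : ∀ {k} → Odd k → ∀ x y → Coprime ∣ x ∣ k → Coprime ∣ y ∣ k → J (x * y) k ≡ J x k · J y k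
J-* (h , refl) x y x⊥k y⊥k rewrite J-odd (x * y) h | J-odd x h | J-odd y h = Residue.jacobi-* h x y x⊥k y⊥k

J-cong : ∀ {k} → Odd k → ∀ x y → Coprime ∣ y ∣ k → x ≈ y [ k ] → J x k ≡ J y k
J-cong (h , refl) x y y⊥k x≈y rewrite J-odd x h | J-odd y h = Residue.jacobi-cong h x y y⊥k x≈y

J-neg : ∀ {k} → OneMod4 k → ∀ x → Coprime ∣ x ∣ k → J (- x) k ≡ J x k
J-neg (t , refl) x x⊥k rewrite J-odd (- x) (t ℕ.+ t) | J-odd x (t ℕ.+ t) =
  Residue.jacobi-neg (t ℕ.+ t) x (parity-double t) x⊥k

J-reciprocity : ∀ {k} x → OneMod4 k → Odd x → Coprime x k → J (+ x) k ≡ J (+ k) x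
J-reciprocity x (t , refl) (g , refl) x⊥k
  rewrite J-odd (+ suc (g ℕ.+ g)) (t ℕ.+ t) | J-odd (+ suc ((t ℕ.+ t) ℕ.+ (t ℕ.+ t))) g =
  jacobi-reciprocity (t ℕ.+ t) g (parity-double t) x⊥k

J-two : ∀ t → J (+ 2) (suc ((t ℕ.+ t) ℕ.+ (t ℕ.+ t))) ≡ parity t
J-two t = trans (J-odd (+ 2) (t ℕ.+ t)) (jacobi-two (t ℕ.+ t) t refl)

J⊕⇒square : ∀ {p} → Prime p → Odd p → ∀ x → Coprime ∣ x ∣ p → J x p ≡ ⊕ →
            ¬ ¬ (∃ λ y → (+ p) Unsigned.∣ (y * y - x))
J⊕⇒square pp (h , refl) x x⊥p J≡⊕ = jacobi⊕⇒square h pp x x⊥p (trans (sym (J-odd x h)) J≡⊕)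

J-square : ∀ {k} → Odd k → ∀ x → Coprime ∣ x ∣ k → J (x * x) k ≡ ⊕
J-square {k} odd x x⊥k = trans (J-* odd x x x⊥k x⊥k) (s*s≡+ (J x k))

coprime-abs-* : ∀ x y {k} → Coprime ∣ x ∣ k → Coprime ∣ y ∣ k → Coprime ∣ x * y ∣ k
coprime-abs-* x y x⊥k y⊥k = subst (λ n → Coprime n _) (sym (ℤ.abs-* x y)) (coprime-* {∣ x ∣} x⊥k y⊥k)

coprime-∣ˡ : ∀ {a b k} → a ℕ.∣ b → Coprime b k → Coprime a k
coprime-∣ˡ a∣b b⊥k (d∣a , d∣k) = b⊥k (ℕ.∣-trans d∣a a∣b , d∣k)

coprime-∣ʳ : ∀ {x a b} → a ℕ.∣ b → Coprime x b → Coprime x a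
coprime-∣ʳ a∣b x⊥b (d∣x , d∣a) = x⊥b (d∣x , ℕ.∣-trans d∣a a∣b)

coprime-abs-*ˡ : ∀ x y {k} → Coprime ∣ x * y ∣ k → Coprime ∣ x ∣ k
coprime-abs-*ˡ x y = coprime-∣ˡ (ℕ.divides ∣ y ∣ (trans (ℤ.abs-* x y) (ℕ.*-comm ∣ x ∣ ∣ y ∣)))

coprime-≈ : ∀ {a b k} → a ≈ b [ k ] → Coprime ∣ b ∣ k → Coprime ∣ a ∣ k
coprime-≈ {a} {b} {k} (congruent p) b⊥k {d} (d∣a , d∣k) =
  b⊥k (∣-resp-≈ {a = a} {b} (congruent (∣ᵤ⇒∣ (ℕ.∣-trans d∣k (∣⇒∣ᵤ p)))) d∣a , d∣k)

-- The sign count modulo a b has no evident relation to the counts modulo a and b. Reciprocity moves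
-- the modulus into the numerator, where `J-*` applies, and back.
J-*-denominator : ∀ {a b} x → OneMod4 a → OneMod4 b → Coprime x (a ℕ.* b) →
                  J (+ x) (a ℕ.* b) ≡ J (+ x) a · J (+ x) b
J-*-denominator {a} {b} x a₁ b₁ x⊥ab = [ even , (λ odd → numeratorOdd x odd x⊥ab) ]′ (even⊎odd x)
  where
  ab₁ = oneMod4-* a₁ b₁
  open ≡-Reasoning
  numeratorOdd : ∀ x → Odd x → Coprime x (a ℕ.* b) → J (+ x) (a ℕ.* b) ≡ J (+ x) a · J (+ x) b
  numeratorOdd x odd x⊥ab = begin
    J (+ x) (a ℕ.* b)       ≡⟨ J-reciprocity x ab₁ odd x⊥ab ⟩
    J (+ (a ℕ.* b)) x       ≡⟨ cong (λ y → J y x) (ℤ.pos-* a b) ⟩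
    J (+ a * + b) x         ≡⟨ J-* odd (+ a) (+ b) (Coprime.sym x⊥a) (Coprime.sym x⊥b) ⟩
    J (+ a) x · J (+ b) x   ≡⟨ sym (cong₂ _·_ (J-reciprocity x a₁ odd x⊥a) (J-reciprocity x b₁ odd x⊥b)) ⟩
    J (+ x) a · J (+ x) b   ∎
    where
    x⊥a = coprime-∣ʳ (ℕ.m∣m*n b) x⊥ab
    x⊥b = coprime-∣ʳ (ℕ.n∣m*n a) x⊥ab
  -- An even numerator is shifted by a b to make reciprocity applicable.
  even : (∃ λ h → x ≡ h ℕ.+ h) → J (+ x) (a ℕ.* b) ≡ J (+ x) a · J (+ x) b
  even (h , x≡2h) = begin
    J (+ x) (a ℕ.* b)       ≡⟨ sym (drop-ab ab₁ ℕ.∣-refl) ⟩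
    J (+ x′) (a ℕ.* b)      ≡⟨ numeratorOdd x′ odd (Coprime.coprime-+ x⊥ab) ⟩
    J (+ x′) a · J (+ x′) b ≡⟨ cong₂ _·_ (drop-ab a₁ (ℕ.m∣m*n b)) (drop-ab b₁ (ℕ.n∣m*n a)) ⟩
    J (+ x) a · J (+ x) b   ∎
    where
    x′ = a ℕ.* b ℕ.+ x
    odd : Odd x′
    odd with g , ab≡ ← oneMod4⇒odd ab₁ = g ℕ.+ h , trans (cong₂ ℕ._+_ ab≡ x≡2h) (eq g h)
      where
      eq : ∀ g h → suc (g ℕ.+ g) ℕ.+ (h ℕ.+ h) ≡ suc ((g ℕ.+ h) ℕ.+ (g ℕ.+ h))
      eq = ℕSolver.solve-∀
    eq : ∀ c x → c + x - x ≡ c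
    eq = solve-∀
    drop-ab : ∀ {k} → OneMod4 k → k ℕ.∣ a ℕ.* b → J (+ x′) k ≡ J (+ x) k
    drop-ab {k} k₁ k∣ab = J-cong (oneMod4⇒odd k₁) (+ x′) (+ x) (coprime-∣ʳ k∣ab x⊥ab)
      (congruent (subst (+ k ∣_) (sym (trans (cong (_- + x) (ℤ.pos-+ (a ℕ.* b) x)) (eq (+ (a ℕ.* b)) (+ x)))) (∣ᵤ⇒∣ k∣ab)))

J-1 : ∀ {k} → Odd k → J 1ℤ k ≡ ⊕
J-1 {k} odd = J-square odd 1ℤ (Coprime.1-coprimeTo k)

J-product-numerator : ∀ {k} → Odd k → ∀ qs → Coprime (product qs) k → ∏ (λ q → J (+ q) k) qs ≡ J (+ product qs) k
J-product-numerator odd []       _   = sym (J-1 odd)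
J-product-numerator {k} odd (q ∷ qs) qs⊥k = begin
  J (+ q) k · ∏ (λ q → J (+ q) k) qs   ≡⟨ cong (J (+ q) k ·_) (J-product-numerator odd qs qs′⊥k) ⟩
  J (+ q) k · J (+ product qs) k       ≡⟨ sym (J-* odd (+ q) (+ product qs) (coprime-∣ˡ (ℕ.m∣m*n (product qs)) qs⊥k) qs′⊥k) ⟩
  J (+ q * + product qs) k             ≡⟨ cong (λ x → J x k) (sym (ℤ.pos-* q (product qs))) ⟩
  J (+ (q ℕ.* product qs)) k           ∎
  where
  open ≡-Reasoning
  qs′⊥k = coprime-∣ˡ (ℕ.n∣m*n q) qs⊥k

oneMod4-product : ∀ {ps} → All OneMod4 ps → OneMod4 (product ps)
oneMod4-product []         = 0 , refl
oneMod4-product (p₁ ∷ ps₁) = oneMod4-* p₁ (oneMod4-product ps₁)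

J-product-denominator : ∀ x {ps} → All OneMod4 ps → Coprime x (product ps) → ∏ (λ p → J (+ x) p) ps ≡ J (+ x) (product ps)
J-product-denominator x []                       _    = refl
J-product-denominator x {p ∷ ps} (p₁ ∷ ps₁) x⊥ps = trans
  (cong (J (+ x) p ·_) (J-product-denominator x ps₁ (coprime-∣ʳ (ℕ.n∣m*n p) x⊥ps)))
  (sym (J-*-denominator x p₁ (oneMod4-product ps₁) x⊥ps))

J-◃1* : ∀ {k} → OneMod4 k → ∀ s x → Coprime ∣ x ∣ k → J ((s ◃ 1) * x) k ≡ J x k
J-◃1* {k} k₁ ⊕ x x⊥k = cong (λ y → J y k) (ℤ.*-identityˡ x)
J-◃1* {k} k₁ ⊖ x x⊥k = trans (cong (λ y → J y k) (ℤ.-1*i≡-i x)) (J-neg k₁ x x⊥k)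

coprime-◃1 : ∀ s k → Coprime ∣ s ◃ 1 ∣ k
coprime-◃1 ⊕ k = Coprime.1-coprimeTo k
coprime-◃1 ⊖ k = Coprime.1-coprimeTo k

-- Symbols extracted from the conic

-- Read modulo m′ and, after division by e, modulo e, the equation expresses
-- e f and m′ n f as squares.
J-conic : ∀ {e m′ f n} → OneMod4 e → OneMod4 m′ → Coprime e m′ → Coprime f e → Coprime f m′ → Coprime n e →
  ∀ s x₁ y z → Coprime ∣ z ∣ m′ → Coprime ∣ y ∣ e →
  + e * (x₁ * x₁) ≡ + m′ * + n * (y * y) + (s ◃ 1) * (z * z * + f) →
  J (+ f) (e ℕ.* m′) · J (+ n) e ≡ ⊕
J-conic {e} {m′} {f} {n} e₁ m′₁ e⊥m′ f⊥e f⊥m′ n⊥e s x₁ y z z⊥m′ y⊥e eqn = combine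
  (J (+ f) e) (J (+ f) m′) (J (+ n) e) (J (+ m′) e) (J (+ e) m′)
  (J-reciprocity m′ e₁ (oneMod4⇒odd m′₁) (Coprime.sym e⊥m′)) modm′ mode
  (J-*-denominator f e₁ m′₁ (Coprime.sym (coprime-* (Coprime.sym f⊥e) (Coprime.sym f⊥m′))))
  where
  open ≡-Reasoning
  u = s ◃ 1
  -- Only (m′/e) and (n/e) are free; the clauses are the four sign patterns consistent with the
  -- relations.
  combine : ∀ {fm} fe fm′ ne m′e em′ → m′e ≡ em′ → em′ · fm′ ≡ ⊕ → m′e · ne ≡ fe → fm ≡ fe · fm′ → fm · ne ≡ ⊕
  combine ⊕ ⊕ ⊕ ⊕ ⊕ refl refl refl refl = refl
  combine ⊕ ⊖ ⊖ ⊖ ⊖ refl refl refl refl = refl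
  combine ⊖ ⊕ ⊖ ⊕ ⊕ refl refl refl refl = refl
  combine ⊖ ⊖ ⊕ ⊖ ⊖ refl refl refl refl = refl

  w = z * z * (+ e * + f)
  w⊥m′ : Coprime ∣ w ∣ m′
  w⊥m′ = coprime-abs-* (z * z) (+ e * + f) (coprime-abs-* z z z⊥m′ z⊥m′) (coprime-abs-* (+ e) (+ f) e⊥m′ f⊥m′)
  -- Multiplying the equation by e turns its left side into the square (e x₁)², and its right side
  -- into ± z² e f modulo m′.
  x : ℤ
  x = + e * x₁
  x²≈ : x * x ≈ u * w [ m′ ]
  x²≈ = congruent (divides (+ e * + n * (y * y)) (begin
    x * x - u * w                                              ≡⟨ eq₁ (+ e) x₁ u z (+ f) ⟩
    + e * (+ e * (x₁ * x₁)) - + e * (u * (z * z * + f))        ≡⟨ cong (λ v → + e * v - + e * (u * (z * z * + f))) eqn ⟩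
    + e * (+ m′ * + n * (y * y) + u * (z * z * + f)) - + e * (u * (z * z * + f)) ≡⟨ eq₂ (+ e) (+ m′) (+ n) y (u * (z * z * + f)) ⟩
    + e * + n * (y * y) * + m′                                 ∎))
    where
    eq₁ : ∀ e x u z f → e * x * (e * x) - u * (z * z * (e * f)) ≡ e * (e * (x * x)) - e * (u * (z * z * f))
    eq₁ = solve-∀
    eq₂ : ∀ e m n y v → e * (m * n * (y * y) + v) - e * v ≡ e * n * (y * y) * m
    eq₂ = solve-∀
  uw⊥m′ : Coprime ∣ u * w ∣ m′
  uw⊥m′ = coprime-abs-* u w (coprime-◃1 s m′) w⊥m′
  modm′ : J (+ e) m′ · J (+ f) m′ ≡ ⊕
  modm′ = begin
    J (+ e) m′ · J (+ f) m′               ≡⟨ sym (J-* odd (+ e) (+ f) e⊥m′ f⊥m′) ⟩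
    J (+ e * + f) m′                      ≡⟨ cong (_· J (+ e * + f) m′) (sym (J-square odd z z⊥m′)) ⟩
    J (z * z) m′ · J (+ e * + f) m′       ≡⟨ sym (J-* odd (z * z) (+ e * + f) (coprime-abs-* z z z⊥m′ z⊥m′) (coprime-abs-* (+ e) (+ f) e⊥m′ f⊥m′)) ⟩
    J w m′                                ≡⟨ sym (J-◃1* m′₁ s w w⊥m′) ⟩
    J (u * w) m′                          ≡⟨ sym (J-cong odd (x * x) (u * w) uw⊥m′ x²≈) ⟩
    J (x * x) m′                          ≡⟨ J-square odd x (coprime-abs-*ˡ x x (coprime-≈ x²≈ uw⊥m′)) ⟩
    ⊕                                     ∎
    where odd = oneMod4⇒odd m′₁

  odd = oneMod4⇒odd e₁
  m′n⊥e : Coprime ∣ + m′ * + n ∣ e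
  m′n⊥e = coprime-abs-* (+ m′) (+ n) (Coprime.sym e⊥m′) n⊥e
  yy⊥e : Coprime ∣ y * y ∣ e
  yy⊥e = coprime-abs-* y y y⊥e y⊥e
  v = + m′ * + n * (y * y)
  v⊥e : Coprime ∣ v ∣ e
  v⊥e = coprime-abs-* (+ m′ * + n) (y * y) m′n⊥e yy⊥e
  -- Modulo e the left side of the equation vanishes, leaving m′ n y² ≡ z² (-u f).
  t : ℤ
  t = - u * + f
  zzt≈v : z * z * t ≈ v [ e ]
  zzt≈v = congruent (divides (- (x₁ * x₁)) (begin
    z * z * t - v                    ≡⟨ eq₁ z u (+ f) v ⟩
    - (v + u * (z * z * + f))        ≡⟨ cong -_ (sym eqn) ⟩
    - (+ e * (x₁ * x₁))              ≡⟨ eq₂ (+ e) (x₁ * x₁) ⟩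
    - (x₁ * x₁) * + e                ∎))
    where
    eq₁ : ∀ z u f v → z * z * (- u * f) - v ≡ - (v + u * (z * z * f))
    eq₁ = solve-∀
    eq₂ : ∀ e x → - (e * x) ≡ - x * e
    eq₂ = solve-∀
  -- Inherited through the congruence: m′, n and y are all prime to e, so z² t is too.
  z⊥e : Coprime ∣ z ∣ e
  z⊥e = coprime-abs-*ˡ z z (coprime-abs-*ˡ (z * z) t (coprime-≈ zzt≈v v⊥e))
  uf⊥e : Coprime ∣ u * + f ∣ e
  uf⊥e = coprime-abs-* u (+ f) (coprime-◃1 s e) f⊥e
  -uf : t ≡ - (u * + f)
  -uf = sym (ℤ.neg-distribˡ-* u (+ f))
  t⊥e : Coprime ∣ t ∣ e
  t⊥e = subst (λ k → Coprime k e) (sym (trans (cong ∣_∣ -uf) (ℤ.∣-i∣≡∣i∣ (u * + f)))) uf⊥e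
  mode : J (+ m′) e · J (+ n) e ≡ J (+ f) e
  mode = begin
    J (+ m′) e · J (+ n) e                ≡⟨ sym (J-* odd (+ m′) (+ n) (Coprime.sym e⊥m′) n⊥e) ⟩
    J (+ m′ * + n) e                      ≡⟨ sym (*-identityʳ _) ⟩
    J (+ m′ * + n) e · ⊕                  ≡⟨ cong (J (+ m′ * + n) e ·_) (sym (J-square odd y y⊥e)) ⟩
    J (+ m′ * + n) e · J (y * y) e        ≡⟨ sym (J-* odd (+ m′ * + n) (y * y) m′n⊥e yy⊥e) ⟩
    J v e                                 ≡⟨ sym (J-cong odd (z * z * t) v v⊥e zzt≈v) ⟩
    J (z * z * t) e                       ≡⟨ J-* odd (z * z) t (coprime-abs-* z z z⊥e z⊥e) t⊥e ⟩
    J (z * z) e · J t e                   ≡⟨ cong (_· J t e) (J-square odd z z⊥e) ⟩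
    J t e                                 ≡⟨ cong (λ a → J a e) -uf ⟩
    J (- (u * + f)) e                     ≡⟨ J-neg e₁ (u * + f) uf⊥e ⟩
    J (u * + f) e                         ≡⟨ J-◃1* e₁ s (+ f) f⊥e ⟩
    J (+ f) e                             ∎

-- Coprimality and square-free numbers

prime∤⇒coprime : ∀ {p n} → Prime p → ¬ p ℕ.∣ n → Coprime n p
prime∤⇒coprime pp p∤n (d∣n , d∣p) with prime⇒irreducible pp d∣p
... | inj₁ d≡1  = d≡1
... | inj₂ refl = contradiction d∣n p∤n

-- A nonzero common divisor other than 1 has a prime factor; the common divisor 0, which has no
-- factorisation, is ruled out by b ≠ 0.
no-common-prime⇒coprime : ∀ {a b} → ¬ b ≡ 0 → (∀ p → Prime p → p ℕ.∣ a → ¬ p ℕ.∣ b) → Coprime a b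
no-common-prime⇒coprime {a} {b} b≢0 none {zero}      (_   , 0∣b) = contradiction (ℕ.0∣⇒≡0 0∣b) b≢0
no-common-prime⇒coprime {a} {b} b≢0 none {d@(suc _)} (d∣a , d∣b) with factorise d
... | record { factors = []     ; isFactorisation = d≡1 } = d≡1
... | record { factors = p ∷ ps ; isFactorisation = d≡  ; factorsPrime = pp ∷ _ } =
  contradiction (ℕ.∣-trans p∣d d∣b) (none p pp (ℕ.∣-trans p∣d d∣a))
  where
  p∣d : p ℕ.∣ d
  p∣d = subst (p ℕ.∣_) (sym d≡) (ℕ.m∣m*n (product ps))

squareFree≢0 : ∀ {n} → SquareFree n → ¬ n ≡ 0
squareFree≢0 sf refl = sf 2 prime[2] (4 ℕ.∣0)

squareFree-∣ : ∀ {a b} → a ℕ.∣ b → SquareFree b → SquareFree a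
squareFree-∣ a∣b sf p pp pp∣a = sf p pp (ℕ.∣-trans pp∣a a∣b)

squareFree-*⇒coprime : ∀ a b → SquareFree (a ℕ.* b) → Coprime a b
squareFree-*⇒coprime a b sf = no-common-prime⇒coprime
  (squareFree≢0 (squareFree-∣ (ℕ.n∣m*n a) sf)) (λ p pp p∣a p∣b → sf p pp (ℕ.*-pres-∣ p∣a p∣b))

-- Let g = gcd(e, x), e = e′ g and x = x′ g. Then e′ is prime to x′ and divides x′² g, so e′ ∣ g;
-- but e = e′ g is square-free, whence e′ = 1 and e = g.
squareFree-∣-square : ∀ {e} x → SquareFree e → e ℕ.∣ x ℕ.* x → e ℕ.∣ x
squareFree-∣-square {e} x sf e∣xx =
  byGCD (gcd e x) (gcd[m,n]≢0 e x (inj₁ (squareFree≢0 sf))) (gcd[m,n]∣m e x) (gcd[m,n]∣n e x) gcd-greatest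
  where
  byGCD : ∀ g → ¬ g ≡ 0 → g ℕ.∣ e → g ℕ.∣ x → (∀ {c} → c ℕ.∣ e → c ℕ.∣ x → c ℕ.∣ g) → e ℕ.∣ x
  byGCD g g≢0 (ℕ.divides e′ e≡) g∣x@(ℕ.divides x′ x≡) greatest = subst (ℕ._∣ x) (sym e≡g) g∣x
    where
    instance
      g-nonZero : NonZero g
      g-nonZero = ℕ.≢-nonZero g≢0
    e′⊥x′ : Coprime e′ x′
    e′⊥x′ {i} (i∣e′ , i∣x′) = ℕ.∣1⇒≡1 (ℕ.*-cancelʳ-∣ g (subst (i ℕ.* g ℕ.∣_) (sym (ℕ.*-identityˡ g)) (greatest
      (subst (i ℕ.* g ℕ.∣_) (sym e≡) (ℕ.*-monoˡ-∣ g i∣e′)) (subst (i ℕ.* g ℕ.∣_) (sym x≡) (ℕ.*-monoˡ-∣ g i∣x′)))))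
    e′∣g : e′ ℕ.∣ g
    e′∣g = coprime-divisor e′⊥x′ (coprime-divisor e′⊥x′ (ℕ.*-cancelʳ-∣ g
      (subst₂ ℕ._∣_ e≡ (trans (cong₂ ℕ._*_ x≡ x≡) (eq x′ g)) e∣xx)))
      where
      eq : ∀ x g → x ℕ.* g ℕ.* (x ℕ.* g) ≡ x ℕ.* (x ℕ.* g) ℕ.* g
      eq = ℕSolver.solve-∀
    e′≡1 : e′ ≡ 1
    e′≡1 = squareFree-*⇒coprime e′ g (subst SquareFree e≡ sf) (ℕ.∣-refl , e′∣g)
    e≡g : e ≡ g
    e≡g = trans e≡ (trans (cong (ℕ._* g) e′≡1) (ℕ.*-identityˡ g))

squareFree-product⇒unique : ∀ {ps} → All Prime ps → SquareFree (product ps) → Unique ps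
squareFree-product⇒unique []          sf = []
squareFree-product⇒unique {p ∷ ps} (pp ∷ pps) sf =
  All.tabulate (λ q∈ p≡q → sf p pp (ℕ.*-monoʳ-∣ p (subst (ℕ._∣ product ps) (sym p≡q) (∈⇒∣product q∈)))) ∷
  squareFree-product⇒unique pps (squareFree-∣ (ℕ.n∣m*n p) sf)

-- From the unit to a primitive solution of the conic

square-≡⇒± : ∀ a b → a * a ≡ b * b → ∃ λ s → a ≡ (s ◃ 1) * b
square-≡⇒± a b a²≡b² =
  [ (λ a-b≡0 → ⊕ , trans (ℤ.i-j≡0⇒i≡j a b a-b≡0) (sym (ℤ.*-identityˡ b)))
  , (λ a+b≡0 → ⊖ , trans (ℤ.i-j≡0⇒i≡j a (- b) (trans (cong (λ c → a + c) (ℤ.neg-involutive b)) a+b≡0)) (sym (ℤ.-1*i≡-i b)))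
  ]′ (ℤ.i*j≡0⇒i≡0∨j≡0 (a - b) {a + b} (trans (eq a b) (trans (cong (_- b * b) a²≡b²) (ℤ.+-inverseʳ (b * b)))))
  where
  eq : ∀ a b → (a - b) * (a + b) ≡ a * a - b * b
  eq = solve-∀

-- The norm equation N(x + y √D) = ± d z². The sign is carried as data, since only the square of the
-- norm is known beforehand.
Conic : ℤ → ℤ → ℤ → ℤ → ℤ → Sign → Set
Conic D d x y z s = x * x ≡ D * (y * y) + (s ◃ 1) * (z * z * d)

-- N(x + y √D)² = N(z² d ε) and N ε = 1.
norm-trace⇒conic : ∀ D a b d x y z → Norm4 D a b ≡ + 4 →
  (+ 2) * (x * x + (+ D) * y * y) ≡ z * z * (+ d) * a → (+ 4) * x * y ≡ z * z * (+ d) * b →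
  ∃ (Conic (+ D) (+ d) x y z)
norm-trace⇒conic D a b d x y z norm trace irr =
  let s , N≡ = square-≡⇒± N W N²≡W² in s , trans (eq₃ (x * x) (+ D * (y * y))) (cong (λ n → + D * (y * y) + n) N≡)
  where
  open ≡-Reasoning
  N = x * x - + D * (y * y)
  W = z * z * + d
  -- The two bracketed expressions are the coordinates of 2 (x + y √D)², so this is multiplicativity
  -- of the norm, N(2α²) = 4 N(α)².
  eq₁ : ∀ D x y → + 4 * ((x * x - D * (y * y)) * (x * x - D * (y * y))) ≡
        (+ 2 * (x * x + D * y * y)) * (+ 2 * (x * x + D * y * y)) - D * ((+ 4 * x * y) * (+ 4 * x * y))
  eq₁ = solve-∀
  eq₂ : ∀ D W a b → (W * a) * (W * a) - D * ((W * b) * (W * b)) ≡ (a * a - D * b * b) * (W * W)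
  eq₂ = solve-∀
  N²≡W² : N * N ≡ W * W
  N²≡W² = ℤ.*-cancelˡ-≡ (+ 4) (N * N) (W * W) (begin
    + 4 * (N * N)                                        ≡⟨ eq₁ (+ D) x y ⟩
    _                                                    ≡⟨ cong₂ (λ t i → t * t - + D * (i * i)) trace irr ⟩
    (W * a) * (W * a) - + D * ((W * b) * (W * b))        ≡⟨ eq₂ (+ D) W a b ⟩
    (a * a - + D * b * b) * (W * W)                      ≡⟨ cong (_* (W * W)) norm ⟩
    + 4 * (W * W)                                        ∎)
  eq₃ : ∀ a b → a ≡ b + (a - b)
  eq₃ = solve-∀

Primitive : ℤ → ℤ → ℤ → Set
Primitive x y z = ∀ p → Prime p → p ℕ.∣ ∣ x ∣ → p ℕ.∣ ∣ y ∣ → ¬ p ℕ.∣ ∣ z ∣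

-- The equation is homogeneous of degree two in x, y, z, so their common divisor can be removed; z ≠
-- 0 makes it nonzero.
primitive-conic : ∀ D d x y z s → ¬ z ≡ 0ℤ → Conic D d x y z s →
  ∃ λ x → ∃ λ y → ∃ λ z → Conic D d x y z s × Primitive x y z
primitive-conic D d x y z s z≢0 conic =
  byGCD (gcd ∣ x ∣ (gcd ∣ y ∣ ∣ z ∣)) (gcd[m,n]≢0 ∣ x ∣ _ (inj₂ (gcd[m,n]≢0 ∣ y ∣ ∣ z ∣ (inj₂ (z≢0 ∘ ℤ.∣i∣≡0⇒i≡0)))))
    (∣ᵤ⇒∣ (gcd[m,n]∣m ∣ x ∣ _)) (∣ᵤ⇒∣ (ℕ.∣-trans (gcd[m,n]∣n ∣ x ∣ _) (gcd[m,n]∣m ∣ y ∣ ∣ z ∣)))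
    (∣ᵤ⇒∣ (ℕ.∣-trans (gcd[m,n]∣n ∣ x ∣ _) (gcd[m,n]∣n ∣ y ∣ ∣ z ∣)))
    (λ c∣x c∣y c∣z → gcd-greatest c∣x (gcd-greatest c∣y c∣z))
  where
  open ≡-Reasoning
  u = s ◃ 1
  eq₁ : ∀ x g → (x * x) * g * g ≡ (x * g) * (x * g)
  eq₁ = solve-∀
  eq₂ : ∀ D y u z d g → D * ((y * g) * (y * g)) + u * ((z * g) * (z * g) * d) ≡ (D * (y * y) + u * (z * z * d)) * g * g
  eq₂ = solve-∀
  byGCD : ∀ g → ¬ g ≡ 0 → + g ∣ x → + g ∣ y → + g ∣ z →
          (∀ {c} → c ℕ.∣ ∣ x ∣ → c ℕ.∣ ∣ y ∣ → c ℕ.∣ ∣ z ∣ → c ℕ.∣ g) →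
          ∃ λ x → ∃ λ y → ∃ λ z → Conic D d x y z s × Primitive x y z
  byGCD g g≢0 (divides x′ x≡) (divides y′ y≡) (divides z′ z≡) greatest = x′ , y′ , z′ , conic′ , coprime
    where
    instance
      g-nonZero : NonZero g
      g-nonZero = ℕ.≢-nonZero g≢0
    conic′ : Conic D d x′ y′ z′ s
    conic′ = ℤ.*-cancelʳ-≡ _ _ (+ g) (ℤ.*-cancelʳ-≡ _ _ (+ g) (begin
      (x′ * x′) * + g * + g                               ≡⟨ eq₁ x′ (+ g) ⟩
      (x′ * + g) * (x′ * + g)                             ≡⟨ cong₂ _*_ (sym x≡) (sym x≡) ⟩
      x * x                                               ≡⟨ conic ⟩
      D * (y * y) + u * (z * z * d)                       ≡⟨ cong₂ (λ y z → D * (y * y) + u * (z * z * d)) y≡ z≡ ⟩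
      D * ((y′ * + g) * (y′ * + g)) + u * ((z′ * + g) * (z′ * + g) * d) ≡⟨ eq₂ D y′ u z′ d (+ g) ⟩
      (D * (y′ * y′) + u * (z′ * z′ * d)) * + g * + g     ∎))
    lift : ∀ {p v} v′ → v ≡ v′ * + g → p ℕ.∣ ∣ v′ ∣ → p ℕ.* g ℕ.∣ ∣ v ∣
    lift {p} {v} v′ v≡ p∣v′ = subst (p ℕ.* g ℕ.∣_) (sym (trans (cong ∣_∣ v≡) (ℤ.abs-* v′ (+ g)))) (ℕ.*-monoˡ-∣ g p∣v′)
    coprime : Primitive x′ y′ z′
    coprime p pp p∣x′ p∣y′ p∣z′ = ¬prime[1] (subst Prime (ℕ.∣1⇒≡1 (ℕ.*-cancelʳ-∣ g (subst (p ℕ.* g ℕ.∣_) (sym (ℕ.*-identityˡ g))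
      (greatest (lift x′ x≡ p∣x′) (lift y′ y≡ p∣y′) (lift z′ z≡ p∣z′))))) pp)

euclid-abs : ∀ {p} a b → Prime p → p ℕ.∣ ∣ a * b ∣ → p ℕ.∣ ∣ a ∣ ⊎ p ℕ.∣ ∣ b ∣
euclid-abs {p} a b pp = euclidsLemma ∣ a ∣ ∣ b ∣ pp ∘ subst (p ℕ.∣_) (ℤ.abs-* a b)

euclid-square : ∀ {p} a → Prime p → p ℕ.∣ ∣ a * a ∣ → p ℕ.∣ ∣ a ∣
euclid-square a pp = [ id , id ]′ ∘ euclid-abs a a pp

prime∤1 : ∀ {p} → Prime p → ¬ p ℕ.∣ 1
prime∤1 pp p∣1 = ¬prime[1] (subst Prime (ℕ.∣1⇒≡1 p∣1) pp)

-- Brings the conic into the form that `J-conic` expects: e is square-free and divides x², so x = e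
-- x₁ and one factor e cancels. The two coprimality conditions then follow from primitivity.
J-primitive-conic : ∀ {e m′ f n} → SquareFree (e ℕ.* m′) → SquareFree (e ℕ.* f) → Coprime f m′ →
  Coprime (e ℕ.* m′) n → OneMod4 e → OneMod4 m′ → ∀ s x y z →
  Conic (+ (e ℕ.* m′ ℕ.* n)) (+ (e ℕ.* f)) x y z s → Primitive x y z →
  J (+ f) (e ℕ.* m′) · J (+ n) e ≡ ⊕
J-primitive-conic {e} {m′} {f} {n} sfm sfd f⊥m′ m⊥n e₁ m′₁ s x y z conic prim =
  J-conic e₁ m′₁ e⊥m′ f⊥e f⊥m′ n⊥e s x₁ y z z⊥m′ y⊥e reduced
  where
  open ≡-Reasoning
  u = s ◃ 1
  e⊥m′ : Coprime e m′
  e⊥m′ = squareFree-*⇒coprime e m′ sfm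
  f⊥e : Coprime f e
  f⊥e = Coprime.sym (squareFree-*⇒coprime e f sfd)
  n⊥e : Coprime n e
  n⊥e = Coprime.sym (coprime-∣ˡ (ℕ.m∣m*n m′) m⊥n)
  m′≢0 : ¬ m′ ≡ 0
  m′≢0 = squareFree≢0 (squareFree-∣ (ℕ.n∣m*n e) sfm)
  e≢0 : ¬ e ≡ 0
  e≢0 = squareFree≢0 (squareFree-∣ (ℕ.m∣m*n m′) sfm)
  instance
    e-nonZero : NonZero e
    e-nonZero = ℕ.≢-nonZero e≢0

  R : ℤ
  R = + m′ * + n * (y * y) + u * (z * z * + f)
  x²≡Re : x * x ≡ R * + e
  x²≡Re = begin
    x * x                                                            ≡⟨ conic ⟩
    + (e ℕ.* m′ ℕ.* n) * (y * y) + u * (z * z * + (e ℕ.* f))         ≡⟨ cong₂ (λ a b → a * (y * y) + u * (z * z * b))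
                                                                          (trans (ℤ.pos-* (e ℕ.* m′) n) (cong (_* + n) (ℤ.pos-* e m′))) (ℤ.pos-* e f) ⟩
    + e * + m′ * + n * (y * y) + u * (z * z * (+ e * + f))           ≡⟨ eq (+ e) (+ m′) (+ n) (y * y) u (z * z) (+ f) ⟩
    R * + e                                                          ∎
    where
    eq : ∀ e m n y u z f → e * m * n * y + u * (z * (e * f)) ≡ (m * n * y + u * (z * f)) * e
    eq = solve-∀
  e∣x : + e ∣ x
  e∣x = ∣ᵤ⇒∣ (squareFree-∣-square ∣ x ∣ (squareFree-∣ (ℕ.m∣m*n m′) sfm)
    (subst (e ℕ.∣_) (ℤ.abs-* x x) (∣⇒∣ᵤ (divides R x²≡Re))))
  x₁ : ℤ
  x₁ = _∣_.quotient e∣x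
  x≡x₁e : x ≡ x₁ * + e
  x≡x₁e = _∣_.equality e∣x
  reduced : + e * (x₁ * x₁) ≡ R
  reduced = ℤ.*-cancelʳ-≡ (+ e * (x₁ * x₁)) R (+ e) (begin
    + e * (x₁ * x₁) * + e        ≡⟨ eq (+ e) x₁ ⟩
    (x₁ * + e) * (x₁ * + e)      ≡⟨ sym (cong₂ _*_ x≡x₁e x≡x₁e) ⟩
    x * x                        ≡⟨ x²≡Re ⟩
    R * + e                      ∎)
    where
    eq : ∀ e x → e * (x * x) * e ≡ (x * e) * (x * e)
    eq = solve-∀
  x₁∣x : ∀ {p} → p ℕ.∣ ∣ x₁ ∣ → p ℕ.∣ ∣ x ∣
  x₁∣x {p} p∣x₁ = subst (p ℕ.∣_) (sym (trans (cong ∣_∣ x≡x₁e) (ℤ.abs-* x₁ (+ e)))) (ℕ.∣m⇒∣m*n e p∣x₁)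

  -- A prime p dividing z and m′ divides e x₁² but not e, hence x₁. Cancelling one p leaves p ∣
  -- (m′/p) n y², where m′/p and n are prime to p, so p ∣ y as well, against primitivity.
  z⊥m′ : Coprime ∣ z ∣ m′
  z⊥m′ = no-common-prime⇒coprime m′≢0 λ p pp p∣z p∣m′ → common p pp (∣ᵤ⇒∣ p∣z) (∣ᵤ⇒∣ {+ p} {+ m′} p∣m′)
    where
    common : ∀ p → Prime p → + p ∣ z → + p ∣ + m′ → ⊥
    common p pp p∣z@(divides b z≡bp) p∣m′@(divides m″ m′≡m″p) = descend (∣ᵤ⇒∣ p∣x₁)
      where
      instance
        p-nonZero : NonZero p
        p-nonZero = prime⇒nonZero pp
      eq₁ : ∀ m p n y u b z f → m * p * n * y + u * (b * p * z * f) ≡ (m * n * y + u * (b * z * f)) * p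
      eq₁ = solve-∀
      p∣ex₁² : p ℕ.∣ ∣ + e * (x₁ * x₁) ∣
      p∣ex₁² = ∣⇒∣ᵤ (divides (m″ * + n * (y * y) + u * (b * z * + f)) (trans reduced
        (trans (cong₂ (λ m b → m * + n * (y * y) + u * (b * z * + f)) m′≡m″p z≡bp) (eq₁ m″ (+ p) (+ n) (y * y) u b z (+ f)))))
      p∤e : ¬ p ℕ.∣ e
      p∤e p∣e = prime∤1 pp (subst (p ℕ.∣_) (e⊥m′ (p∣e , ∣⇒∣ᵤ p∣m′)) ℕ.∣-refl)
      p∣x₁ : p ℕ.∣ ∣ x₁ ∣
      p∣x₁ = euclid-square x₁ pp ([ (λ p∣e → contradiction p∣e p∤e) , id ]′ (euclid-abs (+ e) (x₁ * x₁) pp p∣ex₁²))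
      p∤m″ : ¬ p ℕ.∣ ∣ m″ ∣
      p∤m″ p∣m″ = sfm p pp (ℕ.∣n⇒∣m*n e (subst (p ℕ.* p ℕ.∣_) (sym (trans (cong ∣_∣ m′≡m″p) (ℤ.abs-* m″ (+ p)))) (ℕ.*-monoˡ-∣ p p∣m″)))
      p∤n : ¬ p ℕ.∣ n
      p∤n p∣n = prime∤1 pp (subst (p ℕ.∣_) (m⊥n (ℕ.∣n⇒∣m*n e (∣⇒∣ᵤ p∣m′) , p∣n)) ℕ.∣-refl)
      eq₂ : ∀ e a p → e * (a * p * (a * p)) ≡ e * (a * a) * p * p
      eq₂ = solve-∀
      eq₃ : ∀ m p n y u b f → m * p * n * y + u * (b * p * (b * p) * f) ≡ (m * n * y + u * (b * b * f) * p) * p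
      eq₃ = solve-∀
      eq₄ : ∀ a b → a ≡ a + b - b
      eq₄ = solve-∀
      eq₅ : ∀ a b p → a * p - b * p ≡ (a - b) * p
      eq₅ = solve-∀
      descend : + p ∣ x₁ → ⊥
      descend (divides a x₁≡ap) = prim p pp (x₁∣x p∣x₁) p∣y (∣⇒∣ᵤ p∣z)
        where
        reduced² : + e * (a * a) * + p ≡ m″ * + n * (y * y) + u * (b * b * + f) * + p
        reduced² = ℤ.*-cancelʳ-≡ _ _ (+ p) (begin
          + e * (a * a) * + p * + p                                        ≡⟨ sym (eq₂ (+ e) a (+ p)) ⟩
          + e * (a * + p * (a * + p))                                      ≡⟨ cong (λ v → + e * (v * v)) (sym x₁≡ap) ⟩
          + e * (x₁ * x₁)                                                  ≡⟨ reduced ⟩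
          + m′ * + n * (y * y) + u * (z * z * + f)                         ≡⟨ cong₂ (λ m z → m * + n * (y * y) + u * (z * z * + f)) m′≡m″p z≡bp ⟩
          m″ * + p * + n * (y * y) + u * (b * + p * (b * + p) * + f)       ≡⟨ eq₃ m″ (+ p) (+ n) (y * y) u b (+ f) ⟩
          (m″ * + n * (y * y) + u * (b * b * + f) * + p) * + p             ∎)
        p∣m″nyy : p ℕ.∣ ∣ m″ * + n * (y * y) ∣
        p∣m″nyy = ∣⇒∣ᵤ (divides (+ e * (a * a) - u * (b * b * + f)) (begin
          m″ * + n * (y * y)                                                        ≡⟨ eq₄ (m″ * + n * (y * y)) (u * (b * b * + f) * + p) ⟩
          m″ * + n * (y * y) + u * (b * b * + f) * + p - u * (b * b * + f) * + p    ≡⟨ cong (_- u * (b * b * + f) * + p) (sym reduced²) ⟩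
          + e * (a * a) * + p - u * (b * b * + f) * + p                             ≡⟨ eq₅ (+ e * (a * a)) (u * (b * b * + f)) (+ p) ⟩
          (+ e * (a * a) - u * (b * b * + f)) * + p                                 ∎))
        p∣y : p ℕ.∣ ∣ y ∣
        p∣y = euclid-square y pp ([ (λ p∣m″n → ⊥-elim ([ p∤m″ , p∤n ]′ (euclid-abs m″ (+ n) pp p∣m″n))) , id ]′
          (euclid-abs (m″ * + n) (y * y) pp p∣m″nyy))

  -- A prime p dividing y and e divides ± z² f, and f is prime to e, so p ∣ z; moreover p ∣ e ∣ x,
  -- against primitivity.
  y⊥e : Coprime ∣ y ∣ e
  y⊥e = no-common-prime⇒coprime e≢0 λ p pp p∣y p∣e → common p pp (∣ᵤ⇒∣ p∣y) (∣ᵤ⇒∣ {+ p} {+ e} p∣e)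
    where
    common : ∀ p → Prime p → + p ∣ y → + p ∣ + e → ⊥
    common p pp p∣y@(divides b y≡bp) p∣e@(divides e′ e≡e′p) = prim p pp
      (ℕ.∣-trans (∣⇒∣ᵤ p∣e) (∣⇒∣ᵤ e∣x)) (∣⇒∣ᵤ p∣y) p∣z
      where
      eq₁ : ∀ m n y v → v ≡ m * n * (y * y) + v - m * n * (y * y)
      eq₁ = solve-∀
      eq₂ : ∀ e p x m n b y → e * p * x - m * n * (b * p * y) ≡ (e * x - m * n * (b * y)) * p
      eq₂ = solve-∀
      p∣uzzf : p ℕ.∣ ∣ u * (z * z * + f) ∣
      p∣uzzf = ∣⇒∣ᵤ (divides (e′ * (x₁ * x₁) - + m′ * + n * (b * y)) (begin
        u * (z * z * + f)                                        ≡⟨ eq₁ (+ m′) (+ n) y (u * (z * z * + f)) ⟩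
        R - + m′ * + n * (y * y)                                 ≡⟨ cong (_- + m′ * + n * (y * y)) (sym reduced) ⟩
        + e * (x₁ * x₁) - + m′ * + n * (y * y)                   ≡⟨ cong₂ (λ e b → e * (x₁ * x₁) - + m′ * + n * (b * y)) e≡e′p y≡bp ⟩
        e′ * + p * (x₁ * x₁) - + m′ * + n * (b * + p * y)        ≡⟨ eq₂ e′ (+ p) (x₁ * x₁) (+ m′) (+ n) b y ⟩
        (e′ * (x₁ * x₁) - + m′ * + n * (b * y)) * + p            ∎))
      p∤u : ¬ p ℕ.∣ ∣ u ∣
      p∤u = prime∤1 pp ∘ subst (p ℕ.∣_) (ℤ.abs-◃ s 1)
      p∤f : ¬ p ℕ.∣ f
      p∤f p∣f = prime∤1 pp (subst (p ℕ.∣_) (f⊥e (p∣f , ∣⇒∣ᵤ p∣e)) ℕ.∣-refl)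
      p∣z : p ℕ.∣ ∣ z ∣
      p∣z = euclid-square z pp ([ id , (λ p∣f → contradiction p∣f p∤f) ]′ (euclid-abs (z * z) (+ f) pp
        ([ (λ p∣u → contradiction p∣u p∤u) , id ]′ (euclid-abs u (z * z * + f) pp p∣uzzf))))

-- The set P in terms of Jacobi symbols

%4≡1⇒oneMod4 : ∀ {k} → k ℕ.% 4 ≡ 1 → OneMod4 k
%4≡1⇒oneMod4 {k} k%4≡1 = k ℕ./ 4 , trans (ℕ.m≡m%n+[m/n]*n k 4) (trans (cong (ℕ._+ k ℕ./ 4 ℕ.* 4) k%4≡1) (eq (k ℕ./ 4)))
  where
  eq : ∀ t → 1 ℕ.+ t ℕ.* 4 ≡ suc ((t ℕ.+ t) ℕ.+ (t ℕ.+ t))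
  eq = ℕSolver.solve-∀

primes-oneMod4⇒oneMod4 : ∀ {k} → ¬ k ≡ 0 → (∀ p → Prime p → p ℕ.∣ k → OneMod4 p) → OneMod4 k
primes-oneMod4⇒oneMod4 {k} k≢0 p₁ = subst OneMod4 (sym k≡) (oneMod4-product
  (All.tabulate λ {p} p∈ → p₁ p (All.lookup pps p∈) (subst (p ℕ.∣_) (sym k≡) (∈⇒∣product p∈))))
  where open PrimeFactorisation (factorise k {{ℕ.≢-nonZero k≢0}}) renaming (isFactorisation to k≡; factorsPrime to pps)

-- A symbol +1 makes x a square only up to double negation, which is enough to refute that case and
-- leave the sign -1.
legendreNeg⇒J⊖ : ∀ {p x} → Prime p → Odd p → ¬ p ℕ.∣ x → ¬ p ≡ 2 → LegendreNeg x p → J (+ x) p ≡ ⊖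
legendreNeg⇒J⊖ pp odd p∤x p≢2 (inj₁ (p≡2 , _)) = contradiction p≡2 p≢2
legendreNeg⇒J⊖ {p} {x} pp odd p∤x p≢2 (inj₂ (_ , _ , nonsquare)) with J (+ x) p in J≡
... | ⊖ = refl
... | ⊕ = contradiction nonsquare (J⊕⇒square pp odd (+ x) (prime∤⇒coprime pp p∤x) J≡)

J⊖⇒legendreNeg : ∀ {p x} → Prime p → Odd p → ¬ p ℕ.∣ x → ¬ p ≡ 2 → J (+ x) p ≡ ⊖ → LegendreNeg x p
J⊖⇒legendreNeg {p} {x} pp odd p∤x p≢2 J≡⊖ = inj₂ (p≢2 , p∤x , λ (y , p∣yy-x) → contradiction (trans (sym J≡⊖) (square y p∣yy-x)) λ ())
  where
  x⊥p = prime∤⇒coprime pp p∤x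
  square : ∀ y → p ℕ.∣ ∣ y * y - + x ∣ → J (+ x) p ≡ ⊕
  square y p∣yy-x = trans (sym (J-cong odd (y * y) (+ x) x⊥p yy≈x)) (J-square odd y (coprime-abs-*ˡ y y (coprime-≈ yy≈x x⊥p)))
    where
    yy≈x : y * y ≈ + x [ p ]
    yy≈x = congruent (∣ᵤ⇒∣ p∣yy-x)

m%8-parity : ∀ t → (parity t ≡ ⊕ × suc ((t ℕ.+ t) ℕ.+ (t ℕ.+ t)) ℕ.% 8 ≡ 1) ⊎ (parity t ≡ ⊖ × suc ((t ℕ.+ t) ℕ.+ (t ℕ.+ t)) ℕ.% 8 ≡ 5)
m%8-parity t with even⊎odd t
... | inj₁ (u , refl) = inj₁ (parity-double u , trans (cong (ℕ._% 8) (eq u)) (ℕ.[m+kn]%n≡m%n 1 u 8))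
  where
  eq : ∀ u → suc (((u ℕ.+ u) ℕ.+ (u ℕ.+ u)) ℕ.+ ((u ℕ.+ u) ℕ.+ (u ℕ.+ u))) ≡ 1 ℕ.+ u ℕ.* 8
  eq = ℕSolver.solve-∀
... | inj₂ (u , refl) = inj₂ (cong opposite (parity-double u) , trans (cong (ℕ._% 8) (eq u)) (ℕ.[m+kn]%n≡m%n 5 u 8))
  where
  eq : ∀ u → suc ((suc (u ℕ.+ u) ℕ.+ suc (u ℕ.+ u)) ℕ.+ (suc (u ℕ.+ u) ℕ.+ suc (u ℕ.+ u))) ≡ 5 ℕ.+ u ℕ.* 8
  eq = ℕSolver.solve-∀

-- For m = 1 + 4t the symbol (2/m) is (-1)^t, and t is odd exactly for the residue 5 modulo 8.
J-two-cases : ∀ {m} → OneMod4 m → (J (+ 2) m ≡ ⊕ × m ℕ.% 8 ≡ 1) ⊎ (J (+ 2) m ≡ ⊖ × m ℕ.% 8 ≡ 5)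
J-two-cases (t , refl) = Sum.map (λ (p , r) → trans (J-two t) p , r) (λ (p , r) → trans (J-two t) p , r) (m%8-parity t)

parity⊕⇒2∣ : ∀ n → parity n ≡ ⊕ → 2 ℕ.∣ n
parity⊕⇒2∣ n even with even⊎odd n
... | inj₁ (h , refl) = ℕ.divides h (trans (cong (h ℕ.+_) (sym (ℕ.+-identityʳ h))) (ℕ.*-comm 2 h))
... | inj₂ (h , refl) = contradiction (trans (sym even) (cong opposite (parity-double h))) λ ()

prime≢2⇒odd : ∀ {p} → Prime p → ¬ p ≡ 2 → Odd p
prime≢2⇒odd {p} pp p≢2 with even⊎odd p
... | inj₂ odd        = odd
... | inj₁ (h , p≡2h) = ⊥-elim ([ (λ ()) , p≢2 ∘ sym ]′ (prime⇒irreducible pp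
  (ℕ.divides h (trans p≡2h (trans (cong (h ℕ.+_) (sym (ℕ.+-identityʳ h))) (ℕ.*-comm 2 h))))))

¬odd-2 : ¬ Odd 2
¬odd-2 (zero  , ())
¬odd-2 (suc h , 2≡) = ℕ.1+n≢0 (sym (trans (ℕ.suc-injective (ℕ.suc-injective 2≡)) (ℕ.+-suc h h)))

module _ {m n d : ℕ} (sfm : SquareFree m) (m⊥n : Coprime m n) (p₁ : ∀ p → Prime p → p ℕ.∣ m → OneMod4 p)
         (d∣2mn : n ℕ.% 4 ≡ 3 → d ℕ.∣ 2 ℕ.* (m ℕ.* n)) (d∣mn : ¬ n ℕ.% 4 ≡ 3 → d ℕ.∣ m ℕ.* n) where

  m₁ : OneMod4 m
  m₁ = primes-oneMod4⇒oneMod4 (squareFree≢0 sfm) p₁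

  prime∣m⇒≢2 : ∀ {p} → Prime p → p ℕ.∣ m → ¬ p ≡ 2
  prime∣m⇒≢2 pp p∣m refl = ¬odd-2 (oneMod4⇒odd (p₁ 2 pp p∣m))

  prime∣m⇒∤n : ∀ {p} → Prime p → p ℕ.∣ m → ¬ p ℕ.∣ n
  prime∣m⇒∤n {p} pp p∣m p∣n = prime∤1 pp (subst (p ℕ.∣_) (m⊥n (p∣m , p∣n)) ℕ.∣-refl)

  -- For a prime p ∤ m the symbol (p/m) covers all remaining cases of the definition of P:
  -- it is (m/p) if p is odd, and it is −1 exactly for m ≡ 5 (mod 8) if p = 2.
  signAt : ℕ → Sign
  signAt p with p ℕ.∣? m
  ... | yes _ = J (+ n) p
  ... | no  _ = J (+ p) m

  signAt-∣ : ∀ {p} → p ℕ.∣ m → signAt p ≡ J (+ n) p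
  signAt-∣ {p} p∣m with p ℕ.∣? m
  ... | yes _   = refl
  ... | no  p∤m = contradiction p∣m p∤m

  signAt-∤ : ∀ {p} → ¬ p ℕ.∣ m → signAt p ≡ J (+ p) m
  signAt-∤ {p} p∤m with p ℕ.∣? m
  ... | yes p∣m = contradiction p∣m p∤m
  ... | no  _   = refl

  -- The prime 2 can divide d without dividing m n only if n ≡ 3 modulo 4; this is the situation
  -- that P₂ covers.
  p∣d∧p∤m⇒ : ∀ {p} → Prime p → p ℕ.∣ d → ¬ p ℕ.∣ m → p ℕ.∣ n ⊎ (p ≡ 2 × n ℕ.% 4 ≡ 3)
  p∣d∧p∤m⇒ {p} pp p∣d p∤m with n ℕ.% 4 ℕ.≟ 3
  ... | no  n%4≢3 = inj₁ ([ (λ p∣m → contradiction p∣m p∤m) , id ]′ (euclidsLemma m n pp (ℕ.∣-trans p∣d (d∣mn n%4≢3))))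
  ... | yes n%4≡3 = [ (λ p∣2 → inj₂ (p≡2 (irreducible[2] p∣2) , n%4≡3))
                    , (λ p∣mn → inj₁ ([ (λ p∣m → contradiction p∣m p∤m) , id ]′ (euclidsLemma m n pp p∣mn)))
                    ]′ (euclidsLemma 2 (m ℕ.* n) pp (ℕ.∣-trans p∣d (d∣2mn n%4≡3)))
    where
    p≡2 : p ≡ 1 ⊎ p ≡ 2 → p ≡ 2
    p≡2 (inj₁ refl) = contradiction pp ¬prime[1]
    p≡2 (inj₂ eq)   = eq

  J-flip : ∀ {p} → Prime p → ¬ p ≡ 2 → ¬ p ℕ.∣ m → J (+ p) m ≡ J (+ m) p
  J-flip pp p≢2 p∤m = J-reciprocity _ m₁ (prime≢2⇒odd pp p≢2) (Coprime.sym (prime∤⇒coprime pp p∤m))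

  -- The first part of P consists of divisors of m. The other two lie outside m, because m is prime
  -- to n and odd, so `signAt` takes its second branch there.
  inP⇒signAt⊖ : ∀ {p} → Prime p → InP m n p → signAt p ≡ ⊖
  inP⇒signAt⊖ {p} pp (inj₁ (_ , p∣m , neg)) = trans (signAt-∣ p∣m)
    (legendreNeg⇒J⊖ pp (oneMod4⇒odd (p₁ p pp p∣m)) (prime∣m⇒∤n pp p∣m) (prime∣m⇒≢2 pp p∣m) neg)
  inP⇒signAt⊖ {p} pp (inj₂ (inj₁ (_ , p∣n , neg))) = trans (signAt-∤ p∤m) (J⊖ neg)
    where
    p∤m : ¬ p ℕ.∣ m
    p∤m p∣m = prime∣m⇒∤n pp p∣m p∣n
    J⊖ : LegendreNeg m p → J (+ p) m ≡ ⊖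
    -- As m ≡ 1 modulo 4, the residue 3 in the convention at 2 cannot occur.
    J⊖ (inj₁ (refl , m%8)) with J-two-cases m₁ | m%8
    ... | inj₂ (J≡⊖ , _)   | _          = J≡⊖
    ... | inj₁ (_ , m%8≡1) | inj₁ m%8≡3 = contradiction (trans (sym m%8≡1) m%8≡3) λ ()
    ... | inj₁ (_ , m%8≡1) | inj₂ m%8≡5 = contradiction (trans (sym m%8≡1) m%8≡5) λ ()
    J⊖ neg@(inj₂ (p≢2 , _)) = trans (J-flip pp p≢2 p∤m) (legendreNeg⇒J⊖ pp (prime≢2⇒odd pp p≢2) p∤m p≢2 neg)
  inP⇒signAt⊖ {p} pp (inj₂ (inj₂ (refl , m%8≡5 , _))) = trans (signAt-∤ (λ 2∣m → prime∣m⇒≢2 pp 2∣m refl)) J⊖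
    where
    J⊖ : J (+ 2) m ≡ ⊖
    J⊖ with J-two-cases m₁
    ... | inj₂ (J≡⊖ , _)   = J≡⊖
    ... | inj₁ (_ , m%8≡1) = contradiction (trans (sym m%8≡1) m%8≡5) λ ()

  -- The hypothesis `p ∣ d` confines a prime outside m to the divisors of n or to 2 with n ≡ 3
  -- modulo 4; the symbol (p/m) alone says nothing about n.
  signAt⊖⇒inP : ∀ {p} → Prime p → p ℕ.∣ d → signAt p ≡ ⊖ → InP m n p
  signAt⊖⇒inP {p} pp p∣d sign≡⊖ with p ℕ.∣? m
  ... | yes p∣m = inj₁ (pp , p∣m ,
    J⊖⇒legendreNeg pp (oneMod4⇒odd (p₁ p pp p∣m)) (prime∣m⇒∤n pp p∣m) (prime∣m⇒≢2 pp p∣m) sign≡⊖)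
  ... | no  p∤m with p ℕ.≟ 2 | p∣d∧p∤m⇒ pp p∣d p∤m
  ...   | no  p≢2 | inj₁ p∣n = inj₂ (inj₁ (pp , p∣n ,
    J⊖⇒legendreNeg pp (prime≢2⇒odd pp p≢2) p∤m p≢2 (trans (sym (J-flip pp p≢2 p∤m)) sign≡⊖)))
  ...   | no  p≢2 | inj₂ (p≡2 , _) = contradiction p≡2 p≢2
  ...   | yes refl | p∣n⊎n%4≡3 with J-two-cases m₁ | p∣n⊎n%4≡3
  ...     | inj₁ (J≡⊕ , _)   | _                  = contradiction (trans (sym J≡⊕) sign≡⊖) λ ()
  ...     | inj₂ (_ , m%8≡5) | inj₁ 2∣n           = inj₂ (inj₁ (pp , 2∣n , inj₁ (refl , inj₂ m%8≡5)))
  ...     | inj₂ (_ , m%8≡5) | inj₂ (_ , n%4≡3)   = inj₂ (inj₂ (refl , m%8≡5 , n%4≡3))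

  -- D is listed as the prime factors of e, all dividing m, followed by those of f, none dividing m.
  -- Square-freeness of d rules out repetitions, and `signAt` is -1 exactly on the entries in `l`.
  parity-D∩P : ∀ e m′ f → m ≡ e ℕ.* m′ → d ≡ e ℕ.* f → SquareFree d → Coprime f m →
    ∀ l → Unique l → (∀ p → (p ∈ l) ⇔ (Prime p × p ℕ.∣ d × InP m n p)) →
    parity (length l) ≡ J (+ f) m · J (+ n) e
  parity-D∩P e m′ f m≡ d≡ sfd f⊥m l ul l⇔ = begin
    parity (length l)             ≡⟨ sym (∏-indicator signAt l ul (squareFree-product⇒unique pps (subst SquareFree d≡∏ sfd)) l⊆ neg pos) ⟩
    ∏ signAt (ps ++ qs)           ≡⟨ ∏-++ signAt ps qs ⟩
    ∏ signAt ps · ∏ signAt qs     ≡⟨ cong₂ _·_ (∏-cong ps (λ p∈ → signAt-∣ (∣m p∈))) (∏-cong qs (λ q∈ → signAt-∤ (∤m q∈))) ⟩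
    ∏ (J (+ n)) ps · ∏ (λ q → J (+ q) m) qs
      ≡⟨ cong₂ _·_ (J-product-denominator n (All.tabulate λ {p} p∈ → p₁ p (All.lookup (factorsPrime F) p∈) (∣m p∈)) (subst (Coprime n) e≡ n⊥e))
                   (J-product-numerator (oneMod4⇒odd m₁) qs (subst (λ f → Coprime f m) f≡ f⊥m)) ⟩
    J (+ n) (product ps) · J (+ product qs) m ≡⟨ cong₂ (λ e f → J (+ n) e · J (+ f) m) (sym e≡) (sym f≡) ⟩
    J (+ n) e · J (+ f) m         ≡⟨ *-comm (J (+ n) e) (J (+ f) m) ⟩
    J (+ f) m · J (+ n) e         ∎
    where
    open ≡-Reasoning
    open PrimeFactorisation
    d≢0 = squareFree≢0 sfd
    e∣m : e ℕ.∣ m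
    e∣m = subst (e ℕ.∣_) (sym m≡) (ℕ.m∣m*n m′)
    F : PrimeFactorisation e
    F = factorise e {{ℕ.≢-nonZero λ { refl → d≢0 d≡ }}}
    G : PrimeFactorisation f
    G = factorise f {{ℕ.≢-nonZero λ { refl → d≢0 (trans d≡ (ℕ.*-zeroʳ e)) }}}
    ps = factors F
    qs = factors G
    e≡ = isFactorisation F
    f≡ = isFactorisation G
    n⊥e : Coprime n e
    n⊥e = Coprime.sym (coprime-∣ˡ e∣m m⊥n)
    pps : All Prime (ps ++ qs)
    pps = All.++⁺ (factorsPrime F) (factorsPrime G)
    d≡∏ : d ≡ product (ps ++ qs)
    d≡∏ = trans d≡ (trans (cong₂ ℕ._*_ e≡ f≡) (sym (product-++ ps qs)))
    ∣m : ∀ {p} → p ∈ ps → p ℕ.∣ m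
    ∣m {p} p∈ = ℕ.∣-trans (subst (p ℕ.∣_) (sym e≡) (∈⇒∣product p∈)) e∣m
    ∤m : ∀ {q} → q ∈ qs → ¬ q ℕ.∣ m
    ∤m {q} q∈ q∣m = prime∤1 (All.lookup (factorsPrime G) q∈)
      (subst (q ℕ.∣_) (f⊥m (subst (q ℕ.∣_) (sym f≡) (∈⇒∣product q∈) , q∣m)) ℕ.∣-refl)
    ∈⇒ : ∀ {p} → p ∈ ps ++ qs → Prime p × p ℕ.∣ d
    ∈⇒ {p} p∈ = All.lookup pps p∈ , subst (p ℕ.∣_) (sym d≡∏) (∈⇒∣product p∈)
    l⊆ : ∀ {p} → p ∈ l → p ∈ ps ++ qs
    l⊆ {p} p∈l with pp , p∣d , _ ← Equivalence.to (l⇔ p) p∈l =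
      factorisationHasAllPrimeFactors pp (subst (p ℕ.∣_) d≡∏ p∣d) pps
    neg : ∀ {p} → p ∈ ps ++ qs → p ∈ l → signAt p ≡ ⊖
    neg {p} _ p∈l with pp , _ , inP ← Equivalence.to (l⇔ p) p∈l = inP⇒signAt⊖ pp inP
    pos : ∀ {p} → p ∈ ps ++ qs → p ∉ l → signAt p ≡ ⊕
    pos {p} p∈ p∉l with signAt p in sign≡ | ∈⇒ p∈
    ... | ⊕ | _        = refl
    ... | ⊖ | pp , p∣d = contradiction (Equivalence.from (l⇔ p) (pp , p∣d , signAt⊖⇒inP pp p∣d sign≡)) p∉l

-- Assembly over the greatest common divisor of d and m

J-conic-split : ∀ {m n d} e m′ f → m ≡ e ℕ.* m′ → d ≡ e ℕ.* f → SquareFree m → SquareFree d → Coprime f m →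
  Coprime m n → (∀ p → Prime p → p ℕ.∣ m → OneMod4 p) → ∀ s x y z →
  Conic (+ (m ℕ.* n)) (+ d) x y z s → Primitive x y z → J (+ f) m · J (+ n) e ≡ ⊕
J-conic-split e m′ f refl refl sfm sfd f⊥m m⊥n p₁ =
  J-primitive-conic {e} {m′} {f} sfm sfd (coprime-∣ʳ (ℕ.n∣m*n e) f⊥m) m⊥n (factor₁ (ℕ.m∣m*n m′)) (factor₁ (ℕ.n∣m*n e))
  where
  factor₁ : ∀ {k} → k ℕ.∣ e ℕ.* m′ → OneMod4 k
  factor₁ k∣m = primes-oneMod4⇒oneMod4 (squareFree≢0 (squareFree-∣ k∣m sfm)) (λ p pp p∣k → p₁ p pp (ℕ.∣-trans p∣k k∣m))

theorem6p5 : (m n : ℕ) → 0 ℕ.< m → 0 ℕ.< n → SquareFree m → SquareFree n → Coprime m n →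
    (∀ p → Prime p → p ℕ.∣ m → p ℕ.% 4 ≡ 1) →
    (a b : ℤ) → FundamentalUnit (m ℕ.* n) a b → Norm4 (m ℕ.* n) a b ≡ + 4 →
    (d : ℕ) → 0 ℕ.< d → SquareFree d → SameSqrtExt (m ℕ.* n) a b d →
    (n ℕ.% 4 ≡ 3 → d ℕ.∣ 2 ℕ.* (m ℕ.* n)) → (¬ (n ℕ.% 4 ≡ 3) → d ℕ.∣ m ℕ.* n) →
    (l : List ℕ) → Unique l → (∀ p → (p ∈ l) ⇔ (Prime p × p ℕ.∣ d × InP m n p)) →
    2 ℕ.∣ length l
theorem6p5 m n _ _ sfm _ m⊥n p%4≡1 a b _ norm d _ sfd (x , y , z , z≢0 , trace , irr) d∣2mn d∣mn l ul l⇔ =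
  parity⊕⇒2∣ (length l) (split (gcd d m) (gcd[m,n]∣m d m) (gcd[m,n]∣n d m) gcd-greatest)
  where
  p₁ : ∀ p → Prime p → p ℕ.∣ m → OneMod4 p
  p₁ p pp p∣m = %4≡1⇒oneMod4 (p%4≡1 p pp p∣m)
  split : ∀ e → e ℕ.∣ d → e ℕ.∣ m → (∀ {c} → c ℕ.∣ d → c ℕ.∣ m → c ℕ.∣ e) → parity (length l) ≡ ⊕
  split e (ℕ.divides f d≡fe) (ℕ.divides m′ m≡m′e) greatest =
    let s , conic = norm-trace⇒conic (m ℕ.* n) a b d x y z norm trace irr
        x′ , y′ , z′ , conic′ , primitive′ = primitive-conic (+ (m ℕ.* n)) (+ d) x y z s z≢0 conic
    in trans (parity-D∩P sfm m⊥n p₁ d∣2mn d∣mn e m′ f m≡ d≡ sfd f⊥m l ul l⇔)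
             (J-conic-split e m′ f m≡ d≡ sfm sfd f⊥m m⊥n p₁ s x′ y′ z′ conic′ primitive′)
    where
    m≡ : m ≡ e ℕ.* m′
    m≡ = trans m≡m′e (ℕ.*-comm m′ e)
    d≡ : d ≡ e ℕ.* f
    d≡ = trans d≡fe (ℕ.*-comm f e)
    f⊥m : Coprime f m
    -- A prime dividing f and m divides d and m, hence their gcd e; then its square divides e f = d.
    f⊥m = no-common-prime⇒coprime (squareFree≢0 sfm) λ p pp p∣f p∣m →
      sfd p pp (subst (p ℕ.* p ℕ.∣_) (sym d≡)
        (ℕ.*-pres-∣ (greatest (ℕ.∣-trans p∣f (ℕ.divides e d≡)) p∣m) p∣f))
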